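{- Let $n\ge 2$ and $k\ge 1$ be integers and let $\mathbf y\in\{ -k,-k+1,\dots,k-1,k\}^n$ be an unknown vector. There is an algorithm that chooses query vectors $\mathbf x^{(1)},\dots,\mathbf x^{(s)}\in\mathbb R^n$ and, given the answers $\|\mathbf x^{(j)}-\mathbf y\|_2$ for $j=1,\dots,s$, recovers $\mathbf y$ exactly, where $s=O\!\left(\min\left\{n,\frac{n\log k}{\log n}\right\}\right)$, and which runs in time polynomial in $n$ and $k$.
   Context: $\|\mathbf z\|_2=(\sum_{i=1}^n z_i^2)^{1/2}$. The algorithm learns about $\mathbf y$ only through the answers to its queries. The constant in the $O(\cdot)$ is absolute.
   Formalization: For k = 1 the printed bound is O(0), which is impossible since 3^n vectors y must be distinguished; there log k is read as log 2, so the bound is s = O(min{n, n log max(k,2) / log n}). For k ≥ 2 nothing is changed. -}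

module Defs where

open import Data.Bool.Base using (if_then_else_)
open import Data.Empty using (⊥-elim)
open import Data.Fin.Base using (Fin; toℕ)
open import Data.Integer.Base as ℤ using (ℤ; +_; -[1+_])
import Data.Integer.Properties as ℤ
open import Data.List.Base using (List; []; _∷_; _++_)
open import Data.Nat.Base as ℕ using (ℕ; zero; suc; s≤s)
open import Data.Nat.Coprimality using (Coprime)
import Data.Nat.Properties as ℕ
open import Data.Nat.Tactic.RingSolver using (solve-∀)
open import Data.Product using (∃-syntax; _×_; _,_)
open import Data.Rational
open import Data.Rational.Properties
open import Data.Rational.Solver using (module +-*-Solver)
import Data.Rational.Unnormalised.Base as ℚᵘ
import Data.Rational.Unnormalised.Properties as ℚᵘ
open import Data.Sum.Base using (inj₁; inj₂)
open import Data.Vec.Functional using (Vector; foldr)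
open import Relation.Binary.PropositionalEquality
open import Relation.Nullary using (¬_; does; yes; no)
open +-*-Solver using (solve; con; _:+_; _:*_; _:-_; :-_; _:=_)

-- ℝ is the set of Cauchy sequences of rationals, considered up to _≈ℝ_.

Cauchy : (ℕ → ℚ) → Set
Cauchy x = ∀ ε → 0ℚ < ε → ∃[ N ] ∀ m n → N ℕ.≤ m → N ℕ.≤ n → ∣ x m - x n ∣ ≤ ε

0<½* : ∀ ε → 0ℚ < ε → 0ℚ < ½ * ε
0<½* ε 0<ε = subst (_< ½ * ε) (*-zeroʳ ½) (*-monoʳ-<-pos ½ 0<ε)

½+½ : ∀ ε → ½ * ε + ½ * ε ≡ ε
½+½ = solve 1 (λ e → con ½ :* e :+ con ½ :* e := e) refl

constSeq : ∀ q → Cauchy (λ _ → q)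
constSeq q ε 0<ε = 0 , λ _ _ _ _ → subst (λ z → ∣ z ∣ ≤ ε) (sym (+-inverseʳ q)) (<⇒≤ 0<ε)

+-cauchy : ∀ {x y} → Cauchy x → Cauchy y → Cauchy (λ n → x n + y n)
+-cauchy {x} {y} cx cy ε 0<ε with cx (½ * ε) (0<½* ε 0<ε) | cy (½ * ε) (0<½* ε 0<ε)
... | M , p | N , q = M ℕ.⊔ N , λ m n Km Kn → begin
  ∣ (x m + y m) - (x n + y n) ∣      ≡⟨ cong ∣_∣ (regroup (x m) (y m) (x n) (y n)) ⟩
  ∣ (x m - x n) + (y m - y n) ∣      ≤⟨ ∣p+q∣≤∣p∣+∣q∣ (x m - x n) (y m - y n) ⟩
  ∣ x m - x n ∣ + ∣ y m - y n ∣      ≤⟨ +-mono-≤ (p m n (ℕ.m⊔n≤o⇒m≤o M N Km) (ℕ.m⊔n≤o⇒m≤o M N Kn))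
                                                 (q m n (ℕ.m⊔n≤o⇒n≤o M N Km) (ℕ.m⊔n≤o⇒n≤o M N Kn)) ⟩
  ½ * ε + ½ * ε                      ≡⟨ ½+½ ε ⟩
  ε                                  ∎
  where
  open ≤-Reasoning
  regroup : ∀ a b c d → (a + b) - (c + d) ≡ (a - c) + (b - d)
  regroup = solve 4 (λ a b c d → (a :+ b) :- (c :+ d) := (a :- c) :+ (b :- d)) refl

neg-cauchy : ∀ {x} → Cauchy x → Cauchy (λ n → - x n)
neg-cauchy {x} cx ε 0<ε with cx ε 0<ε
... | N , p = N , λ m n Nm Nn →
  subst (_≤ ε) (trans (sym (∣-p∣≡∣p∣ (x m - x n))) (cong ∣_∣ (neg-distrib-+ (x m) (- x n)))) (p m n Nm Nn)

eventuallyBounded : ∀ {x} → Cauchy x → ∃[ B ] ∃[ N ] 0ℚ < B × (∀ n → N ℕ.≤ n → ∣ x n ∣ ≤ B)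
eventuallyBounded {x} cx with cx 1ℚ (positive⁻¹ 1ℚ)
... | N , p = ∣ x N ∣ + 1ℚ , N , +-mono-≤-< (0≤∣p∣ (x N)) (positive⁻¹ 1ℚ) , λ n Nn → begin
  ∣ x n ∣                      ≡⟨ cong ∣_∣ (split (x N) (x n)) ⟩
  ∣ x N + (x n - x N) ∣        ≤⟨ ∣p+q∣≤∣p∣+∣q∣ (x N) (x n - x N) ⟩
  ∣ x N ∣ + ∣ x n - x N ∣      ≤⟨ +-monoʳ-≤ ∣ x N ∣ (p n N Nn ℕ.≤-refl) ⟩
  ∣ x N ∣ + 1ℚ                 ∎
  where
  open ≤-Reasoning
  split : ∀ a b → b ≡ a + (b - a)
  split = solve 2 (λ a b → b := a :+ (b :- a)) refl

*-mono-≤-nonNeg : ∀ {p q r s} → 0ℚ ≤ r → 0ℚ ≤ q → p ≤ q → r ≤ s → p * r ≤ q * s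
*-mono-≤-nonNeg {p} {q} {r} {s} 0≤r 0≤q p≤q r≤s =
  ≤-trans (*-monoʳ-≤-nonNeg r {{nonNegative 0≤r}} p≤q) (*-monoˡ-≤-nonNeg q {{nonNegative 0≤q}} r≤s)

*-regroup : ∀ a b c d → a * b - c * d ≡ a * (b - d) + (a - c) * d
*-regroup = solve 4 (λ a b c d → a :* b :- c :* d := a :* (b :- d) :+ (a :- c) :* d) refl

divide : ∀ {p ε} → 0ℚ < p → 0ℚ < ε → ∃[ δ ] 0ℚ < δ × p * δ ≡ ε
divide {p} {ε} 0<p 0<ε = (1/ p) * ε
  , subst (_< (1/ p) * ε) (*-zeroʳ (1/ p)) (*-monoʳ-<-pos (1/ p) {{1/pos⇒pos p}} 0<ε)
  , trans (sym (*-assoc p (1/ p) ε)) (trans (cong (_* ε) (*-inverseʳ p)) (*-identityˡ ε))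
  where instance
    p-positive = positive 0<p
    p-nonZero  = pos⇒nonZero p

*-estimate : ∀ {a b c d A B δ} → ∣ a ∣ ≤ A → ∣ d ∣ ≤ B → ∣ a - c ∣ ≤ δ → ∣ b - d ∣ ≤ δ →
             ∣ a * b - c * d ∣ ≤ (A + B) * δ
*-estimate {a} {b} {c} {d} {A} {B} {δ} a≤A d≤B ac bd = begin
  ∣ a * b - c * d ∣                    ≡⟨ cong ∣_∣ (*-regroup a b c d) ⟩
  ∣ a * (b - d) + (a - c) * d ∣        ≤⟨ ∣p+q∣≤∣p∣+∣q∣ (a * (b - d)) ((a - c) * d) ⟩
  ∣ a * (b - d) ∣ + ∣ (a - c) * d ∣    ≡⟨ cong₂ _+_ (∣p*q∣≡∣p∣*∣q∣ a (b - d)) (∣p*q∣≡∣p∣*∣q∣ (a - c) d) ⟩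
  ∣ a ∣ * ∣ b - d ∣ + ∣ a - c ∣ * ∣ d ∣ ≤⟨ +-mono-≤
      (*-mono-≤-nonNeg (0≤∣p∣ (b - d)) (≤-trans (0≤∣p∣ a) a≤A) a≤A bd)
      (*-mono-≤-nonNeg (0≤∣p∣ d) (≤-trans (0≤∣p∣ (a - c)) ac) ac d≤B) ⟩
  A * δ + δ * B                        ≡⟨ cong (λ z → A * δ + z) (*-comm δ B) ⟩
  A * δ + B * δ                        ≡⟨ sym (*-distribʳ-+ δ A B) ⟩
  (A + B) * δ                          ∎
  where open ≤-Reasoning

⊔⊔-split : ∀ {M N P Q k} → (M ℕ.⊔ N) ℕ.⊔ (P ℕ.⊔ Q) ℕ.≤ k →
           (M ℕ.≤ k × N ℕ.≤ k) × (P ℕ.≤ k × Q ℕ.≤ k)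
⊔⊔-split {M} {N} {P} {Q} le =
  let l = ℕ.m⊔n≤o⇒m≤o (M ℕ.⊔ N) (P ℕ.⊔ Q) le
      r = ℕ.m⊔n≤o⇒n≤o (M ℕ.⊔ N) (P ℕ.⊔ Q) le
  in (ℕ.m⊔n≤o⇒m≤o M N l , ℕ.m⊔n≤o⇒n≤o M N l) , (ℕ.m⊔n≤o⇒m≤o P Q r , ℕ.m⊔n≤o⇒n≤o P Q r)

*-cauchy : ∀ {x y} → Cauchy x → Cauchy y → Cauchy (λ n → x n * y n)
*-cauchy {x} {y} cx cy ε 0<ε =
  let (A , M , 0<A , x≤A) = eventuallyBounded {x} cx
      (B , N , 0<B , y≤B) = eventuallyBounded {y} cy
      (δ , 0<δ , eq)      = divide {A + B} {ε} (+-mono-< 0<A 0<B) 0<ε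
      (P , p)             = cx δ 0<δ
      (Q , q)             = cy δ 0<δ
  in (M ℕ.⊔ N) ℕ.⊔ (P ℕ.⊔ Q) , λ m n Km Kn →
     let ((Mm , _) , (Pm , Qm)) = ⊔⊔-split {M} {N} {P} {Q} Km
         ((_ , Nn) , (Pn , Qn)) = ⊔⊔-split {M} {N} {P} {Q} Kn
     in ≤-trans
          (*-estimate {x m} {y m} {x n} {y n} (x≤A m Mm) (y≤B n Nn) (p m n Pm Pn) (q m n Qm Qn))
          (≤-reflexive eq)

isqrt : ℕ → ℕ
isqrt zero = 0
isqrt (suc n) with suc (isqrt n) ℕ.* suc (isqrt n) ℕ.≤? suc n
... | yes _ = suc (isqrt n)
... | no  _ = isqrt n

isqrt-lower : ∀ n → isqrt n ℕ.* isqrt n ℕ.≤ n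
isqrt-lower zero = ℕ.z≤n
isqrt-lower (suc n) with suc (isqrt n) ℕ.* suc (isqrt n) ℕ.≤? suc n
... | yes le = le
... | no  _  = ℕ.m≤n⇒m≤1+n (isqrt-lower n)

isqrt-upper : ∀ n → n ℕ.< suc (isqrt n) ℕ.* suc (isqrt n)
isqrt-upper zero = s≤s ℕ.z≤n
isqrt-upper (suc n) with suc (isqrt n) ℕ.* suc (isqrt n) ℕ.≤? suc n
... | yes _  = ℕ.<-≤-trans (s≤s (isqrt-upper n))
                 (ℕ.*-mono-< (ℕ.n<1+n (suc (isqrt n))) (ℕ.n<1+n (suc (isqrt n))))
... | no ¬le = ℕ.≰⇒> ¬le

-- For q = p / d ≥ 0 and N = m + 1 this is ⌊√(p d N²)⌋ / (d N) = ⌊N d √q⌋ / (N d), so it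
-- lies in (√q - 1 / N , √q]; for q < 0 it is 0.
sqrtApprox : ℕ → ℚ → ℚ
sqrtApprox m (mkℚ (+ p) d-1 _) = + isqrt (p ℕ.* d ℕ.* (N ℕ.* N)) / (d ℕ.* N)
  where d = suc d-1
        N = suc m
sqrtApprox m (mkℚ -[1+ _ ] _ _) = 0ℚ

square-≤ : ∀ s p d-1 N-1 .(c : Coprime p (suc d-1)) → let d = suc d-1; N = suc N-1 in
  s ℕ.* s ℕ.≤ p ℕ.* d ℕ.* (N ℕ.* N) →
  (+ s / (d ℕ.* N)) * (+ s / (d ℕ.* N)) ≤ mkℚ (+ p) d-1 c
square-≤ s p d-1 N-1 c le = toℚᵘ-cancel-≤ (begin
  toℚᵘ (t * t)            ≃⟨ toℚᵘ-homo-* t t ⟩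
  toℚᵘ t ℚᵘ.* toℚᵘ t      ≃⟨ ℚᵘ.*-cong (toℚᵘ-fromℚᵘ r) (toℚᵘ-fromℚᵘ r) ⟩
  r ℚᵘ.* r                ≤⟨ ℚᵘ.*≤* (subst₂ ℤ._≤_ (eqs s s d) eqr (ℤ.+≤+ (ℕ.≤-trans (ℕ.*-monoˡ-≤ d le) (ℕ.≤-reflexive (rearrange p d N))))) ⟩
  ℚᵘ.mkℚᵘ (+ p) d-1       ∎)
  where
  open ℚᵘ.≤-Reasoning
  d N : ℕ
  d = suc d-1
  N = suc N-1
  t = + s / (d ℕ.* N)
  r = ℚᵘ.mkℚᵘ (+ s) (ℕ.pred (d ℕ.* N))
  eqs : ∀ a b c → + (a ℕ.* b ℕ.* c) ≡ + a ℤ.* + b ℤ.* + c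
  eqs a b c = trans (ℤ.pos-* (a ℕ.* b) c) (cong (ℤ._* + c) (ℤ.pos-* a b))
  eqr : + (p ℕ.* ((d ℕ.* N) ℕ.* (d ℕ.* N))) ≡ + p ℤ.* ℚᵘ.↧ (r ℚᵘ.* r)
  eqr = ℤ.pos-* p ((d ℕ.* N) ℕ.* (d ℕ.* N))
  rearrange : ∀ p d N → p ℕ.* d ℕ.* (N ℕ.* N) ℕ.* d ≡ p ℕ.* ((d ℕ.* N) ℕ.* (d ℕ.* N))
  rearrange = solve-∀

square-> : ∀ s p d-1 N-1 .(c : Coprime p (suc d-1)) → let d = suc d-1; N = suc N-1 in
  p ℕ.* d ℕ.* (N ℕ.* N) ℕ.< s ℕ.* s →
  mkℚ (+ p) d-1 c < (+ s / (d ℕ.* N)) * (+ s / (d ℕ.* N))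
square-> s p d-1 N-1 c lt = toℚᵘ-cancel-< (begin-strict
  ℚᵘ.mkℚᵘ (+ p) d-1       <⟨ ℚᵘ.*<* (subst₂ ℤ._<_ eqr (eqs s s d) (ℤ.+<+ (ℕ.≤-<-trans (ℕ.≤-reflexive (sym (rearrange p d N))) (ℕ.*-monoˡ-< d lt)))) ⟩
  r ℚᵘ.* r                ≃⟨ ℚᵘ.*-cong (toℚᵘ-fromℚᵘ r) (toℚᵘ-fromℚᵘ r) ⟨
  toℚᵘ t ℚᵘ.* toℚᵘ t      ≃⟨ toℚᵘ-homo-* t t ⟨
  toℚᵘ (t * t)            ∎)
  where
  open ℚᵘ.≤-Reasoning
  d N : ℕ
  d = suc d-1
  N = suc N-1
  t = + s / (d ℕ.* N)
  r = ℚᵘ.mkℚᵘ (+ s) (ℕ.pred (d ℕ.* N))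
  eqs : ∀ a b c → + (a ℕ.* b ℕ.* c) ≡ + a ℤ.* + b ℤ.* + c
  eqs a b c = trans (ℤ.pos-* (a ℕ.* b) c) (cong (ℤ._* + c) (ℤ.pos-* a b))
  eqr : + (p ℕ.* ((d ℕ.* N) ℕ.* (d ℕ.* N))) ≡ + p ℤ.* ℚᵘ.↧ (r ℚᵘ.* r)
  eqr = ℤ.pos-* p ((d ℕ.* N) ℕ.* (d ℕ.* N))
  rearrange : ∀ p d N → p ℕ.* d ℕ.* (N ℕ.* N) ℕ.* d ≡ p ℕ.* ((d ℕ.* N) ℕ.* (d ℕ.* N))
  rearrange = solve-∀

suc-fraction : ∀ s d-1 N-1 → let d = suc d-1; N = suc N-1 in
  + suc s / (d ℕ.* N) ≤ + s / (d ℕ.* N) + + 1 / N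
suc-fraction s d-1 N-1 = toℚᵘ-cancel-≤ (begin
  toℚᵘ (+ suc s / (d ℕ.* N))                ≃⟨ toℚᵘ-fromℚᵘ (ℚᵘ.mkℚᵘ (+ suc s) D) ⟩
  ℚᵘ.mkℚᵘ (+ suc s) D                       ≤⟨ ℚᵘ.*≤* (subst₂ ℤ._≤_ (ℤ.pos-* (suc s) ((d ℕ.* N) ℕ.* N)) rhs (ℤ.+≤+ le)) ⟩
  a ℚᵘ.+ b                                  ≃⟨ ℚᵘ.+-cong (toℚᵘ-fromℚᵘ a) (toℚᵘ-fromℚᵘ b) ⟨
  toℚᵘ (+ s / (d ℕ.* N)) ℚᵘ.+ toℚᵘ (+ 1 / N) ≃⟨ toℚᵘ-homo-+ (+ s / (d ℕ.* N)) (+ 1 / N) ⟨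
  toℚᵘ (+ s / (d ℕ.* N) + + 1 / N)          ∎)
  where
  open ℚᵘ.≤-Reasoning
  d N D : ℕ
  d = suc d-1
  N = suc N-1
  D = ℕ.pred (d ℕ.* N)
  a = ℚᵘ.mkℚᵘ (+ s) D
  b = ℚᵘ.mkℚᵘ (+ 1) N-1
  rearrange : ∀ s d N → s ℕ.* N ℕ.* (d ℕ.* N) ℕ.+ d ℕ.* N ℕ.* N ≡ suc s ℕ.* (d ℕ.* N ℕ.* N)
  rearrange = solve-∀
  le : suc s ℕ.* (d ℕ.* N ℕ.* N) ℕ.≤ (s ℕ.* N ℕ.+ 1 ℕ.* (d ℕ.* N)) ℕ.* (d ℕ.* N)
  le = ℕ.≤-trans (ℕ.≤-reflexive (sym (rearrange s d N)))
         (ℕ.≤-trans (ℕ.+-monoʳ-≤ (s ℕ.* N ℕ.* (d ℕ.* N)) (ℕ.*-monoʳ-≤ (d ℕ.* N) (ℕ.m≤n*m N d)))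
           (ℕ.≤-reflexive (collect (s ℕ.* N) (d ℕ.* N))))
    where
    collect : ∀ x y → x ℕ.* y ℕ.+ y ℕ.* y ≡ (x ℕ.+ 1 ℕ.* y) ℕ.* y
    collect = solve-∀
  rhs : + ((s ℕ.* N ℕ.+ 1 ℕ.* (d ℕ.* N)) ℕ.* (d ℕ.* N)) ≡ (+ s ℤ.* + N ℤ.+ + 1 ℤ.* + (d ℕ.* N)) ℤ.* + (d ℕ.* N)
  rhs = trans (ℤ.pos-* (s ℕ.* N ℕ.+ 1 ℕ.* (d ℕ.* N)) (d ℕ.* N))
          (cong (ℤ._* + (d ℕ.* N)) (trans (ℤ.pos-+ (s ℕ.* N) (1 ℕ.* (d ℕ.* N)))
            (cong₂ ℤ._+_ (ℤ.pos-* s N) (ℤ.pos-* 1 (d ℕ.* N)))))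

square-mono-≤ : ∀ {p q} → 0ℚ ≤ p → p ≤ q → p * p ≤ q * q
square-mono-≤ 0≤p p≤q = *-mono-≤-nonNeg 0≤p (≤-trans 0≤p p≤q) p≤q p≤q

fraction-nonNeg : ∀ s D .{{_ : ℕ.NonZero D}} → 0ℚ ≤ + s / D
fraction-nonNeg s D = nonNegative⁻¹ (+ s / D) {{normalize-nonNeg s D}}

sqrtApprox-nonNeg : ∀ m q → 0ℚ ≤ sqrtApprox m q
sqrtApprox-nonNeg m (mkℚ (+ p) d-1 _) = fraction-nonNeg (isqrt (p ℕ.* suc d-1 ℕ.* (suc m ℕ.* suc m))) (suc d-1 ℕ.* suc m)
sqrtApprox-nonNeg m (mkℚ -[1+ _ ] _ _) = ≤-refl

sqrtApprox-lower : ∀ m q → 0ℚ < sqrtApprox m q → sqrtApprox m q * sqrtApprox m q ≤ q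
sqrtApprox-lower m (mkℚ (+ p) d-1 c) _ =
  square-≤ (isqrt (p ℕ.* suc d-1 ℕ.* (suc m ℕ.* suc m))) p d-1 m c (isqrt-lower (p ℕ.* suc d-1 ℕ.* (suc m ℕ.* suc m)))
sqrtApprox-lower m (mkℚ -[1+ _ ] _ _) 0<0 = ⊥-elim (<-irrefl refl 0<0)

sqrtApprox-upper : ∀ m q → let t = sqrtApprox m q + + 1 / suc m in q < t * t
sqrtApprox-upper m (mkℚ (+ p) d-1 c) =
  <-≤-trans (square-> (suc (isqrt R)) p d-1 m c (isqrt-upper R))
    (square-mono-≤ (fraction-nonNeg (suc (isqrt R)) (suc d-1 ℕ.* suc m)) (suc-fraction (isqrt R) d-1 m))
  where R = p ℕ.* suc d-1 ℕ.* (suc m ℕ.* suc m)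
sqrtApprox-upper m q@(mkℚ -[1+ _ ] _ _) =
  <-≤-trans (negative⁻¹ q) (square-mono-≤ ≤-refl (+-mono-≤ (≤-refl {0ℚ}) (fraction-nonNeg 1 (suc m))))

archimedean : ∀ {ε} → 0ℚ < ε → ∃[ N ] ∀ n → N ℕ.≤ n → + 1 / suc n ≤ ε
archimedean {mkℚ (+ suc p) d-1 c} _ = suc d-1 , λ n le → toℚᵘ-cancel-≤
  (ℚᵘ.≤-trans (ℚᵘ.≤-reflexive (toℚᵘ-fromℚᵘ (ℚᵘ.mkℚᵘ (+ 1) n)))
    (ℚᵘ.*≤* (subst₂ ℤ._≤_ (ℤ.pos-* 1 (suc d-1)) (ℤ.pos-* (suc p) (suc n))
      (ℤ.+≤+ (ℕ.≤-trans (ℕ.≤-reflexive (ℕ.*-identityˡ (suc d-1)))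
        (ℕ.≤-trans (ℕ.m≤n⇒m≤1+n le) (ℕ.m≤n*m (suc n) (suc p))))))))
archimedean {mkℚ (+ 0) d-1 c} (*<* lt) = ⊥-elim (ℤ.<-irrefl refl (subst (ℤ._< + 0) (ℤ.*-zeroˡ (+ suc d-1)) (subst (+ 0 ℤ.* + suc d-1 ℤ.<_) (ℤ.*-zeroˡ (+ 1)) lt)))
archimedean {mkℚ -[1+ p ] d-1 c} (*<* ())

sqrt-estimate : ∀ {a b t u η h} → 0ℚ ≤ u → 0ℚ ≤ η → 0ℚ < h → η ≤ h →
  (0ℚ < t → t * t ≤ a) → b < (u + η) * (u + η) → a - b ≤ h * h → t ≤ u + (h + h)
sqrt-estimate {a} {b} {t} {u} {η} {h} 0≤u 0≤η 0<h η≤h low up a-b with ≤-total t (u + (h + h))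
... | inj₁ le = le
... | inj₂ ge = ⊥-elim (<-irrefl refl (begin-strict
  a                                  ≡⟨ split a b ⟩
  b + (a - b)                        ≤⟨ +-monoʳ-≤ b a-b ⟩
  b + h * h                          <⟨ +-monoˡ-< (h * h) up ⟩
  (u + η) * (u + η) + h * h          ≤⟨ +-monoˡ-≤ (h * h) (square-mono-≤ (+-mono-≤ 0≤u 0≤η) (+-monoʳ-≤ u η≤h)) ⟩
  w * w + h * h                      ≡⟨ sym (+-identityʳ (w * w + h * h)) ⟩
  w * w + h * h + 0ℚ                 ≤⟨ +-monoʳ-≤ (w * w + h * h) cross ⟩
  w * w + h * h + (h * w + h * w)    ≡⟨ expand w h ⟩
  (w + h) * (w + h)                  ≡⟨ cong (λ z → z * z) (+-assoc u h h) ⟩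
  (u + (h + h)) * (u + (h + h))      ≤⟨ square-mono-≤ 0≤v ge ⟩
  t * t                              ≤⟨ low (<-≤-trans 0<v ge) ⟩
  a                                  ∎))
  where
  open ≤-Reasoning
  w = u + h
  0<h+h : 0ℚ < h + h
  0<h+h = +-mono-< 0<h 0<h
  0<v : 0ℚ < u + (h + h)
  0<v = +-mono-≤-< 0≤u 0<h+h
  0≤v : 0ℚ ≤ u + (h + h)
  0≤v = <⇒≤ 0<v
  0≤hw : 0ℚ ≤ h * w
  0≤hw = subst (_≤ h * w) (*-zeroˡ 0ℚ) (*-mono-≤-nonNeg ≤-refl (<⇒≤ 0<h) (<⇒≤ 0<h) (+-mono-≤ 0≤u (<⇒≤ 0<h)))
  cross : 0ℚ ≤ h * w + h * w
  cross = +-mono-≤ 0≤hw 0≤hw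
  split : ∀ a b → a ≡ b + (a - b)
  split = solve 2 (λ a b → a := b :+ (a :- b)) refl
  expand : ∀ w h → w * w + h * h + (h * w + h * w) ≡ (w + h) * (w + h)
  expand = solve 2 (λ w h → w :* w :+ h :* h :+ (h :* w :+ h :* w) := (w :+ h) :* (w :+ h)) refl

∣∣-bound : ∀ {p q e} → p ≤ q + e → q ≤ p + e → ∣ p - q ∣ ≤ e
∣∣-bound {p} {q} {e} pq qp with ∣p∣≡p∨∣p∣≡-p (p - q)
... | inj₁ eq = subst (_≤ e) (sym eq) (subst (p - q ≤_) (cancel q e) (+-monoˡ-≤ (- q) pq))
  where
  cancel : ∀ q e → q + e - q ≡ e
  cancel = solve 2 (λ q e → q :+ e :- q := e) refl
... | inj₂ eq = subst (_≤ e) (sym eq) (subst₂ _≤_ (swap p q) (cancel p e) (+-monoˡ-≤ (- p) qp))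
  where
  cancel : ∀ q e → q + e - q ≡ e
  cancel = solve 2 (λ q e → q :+ e :- q := e) refl
  swap : ∀ p q → q - p ≡ - (p - q)
  swap = solve 2 (λ p q → q :- p := :- (p :- q)) refl

p≤∣p∣ : ∀ p → p ≤ ∣ p ∣
p≤∣p∣ p with ≤-total 0ℚ p
... | inj₁ 0≤p = ≤-reflexive (sym (0≤p⇒∣p∣≡p 0≤p))
... | inj₂ p≤0 = ≤-trans p≤0 (0≤∣p∣ p)

sqrt-cauchy : ∀ {x} → Cauchy x → Cauchy (λ n → sqrtApprox n (x n))
sqrt-cauchy {x} cx ε 0<ε =
  let h        = ½ * ε
      0<h      = 0<½* ε 0<ε
      0<hh     = subst (_< h * h) (*-zeroʳ h) (*-monoʳ-<-pos h {{positive 0<h}} 0<h)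
      (M , p)  = cx (h * h) 0<hh
      (N , q)  = archimedean {h} 0<h
      half     = λ m n (Km : M ℕ.⊔ N ℕ.≤ m) (Kn : M ℕ.⊔ N ℕ.≤ n) →
        subst (λ e → sqrtApprox m (x m) ≤ sqrtApprox n (x n) + e) (½+½ ε)
          (sqrt-estimate {x m} {x n} (sqrtApprox-nonNeg n (x n)) (fraction-nonNeg 1 (suc n)) 0<h
            (q n (ℕ.m⊔n≤o⇒n≤o M N Kn)) (sqrtApprox-lower m (x m)) (sqrtApprox-upper n (x n))
            (≤-trans (p≤∣p∣ (x m - x n)) (p m n (ℕ.m⊔n≤o⇒m≤o M N Km) (ℕ.m⊔n≤o⇒m≤o M N Kn))))
  in M ℕ.⊔ N , λ m n Km Kn → ∣∣-bound (half m n Km Kn) (half n m Kn Km)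

record ℝ : Set where
  constructor mkℝ
  field
    seq    : ℕ → ℚ
    cauchy : Cauchy seq
open ℝ public

infix  4 _≈ℝ_ _<ℝ_
infixl 6 _+ℝ_ _-ℝ_
infixl 7 _*ℝ_

_≈ℝ_ : ℝ → ℝ → Set
x ≈ℝ y = ∀ ε → 0ℚ < ε → ∃[ N ] ∀ n → N ℕ.≤ n → ∣ seq x n - seq y n ∣ ≤ ε

_<ℝ_ : ℝ → ℝ → Set
x <ℝ y = ∃[ ε ] 0ℚ < ε × ∃[ N ] ∀ n → N ℕ.≤ n → seq x n + ε ≤ seq y n

fromℤ : ℤ → ℝ
fromℤ i = mkℝ (λ _ → i / 1) (constSeq (i / 1))

_+ℝ_ _-ℝ_ _*ℝ_ : ℝ → ℝ → ℝ
mkℝ x cx +ℝ mkℝ y cy = mkℝ (λ n → x n + y n) (+-cauchy {x} {y} cx cy)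
mkℝ x cx -ℝ mkℝ y cy = mkℝ (λ n → x n + - y n) (+-cauchy {x} { λ n → - y n } cx (neg-cauchy {y} cy))
mkℝ x cx *ℝ mkℝ y cy = mkℝ (λ n → x n * y n) (*-cauchy {x} {y} cx cy)

√ : ℝ → ℝ
√ (mkℝ x cx) = mkℝ (λ n → sqrtApprox n (x n)) (sqrt-cauchy {x} cx)

‖_‖₂ : ∀ {n} → Vector ℝ n → ℝ
‖ z ‖₂ = √ (foldr (λ a s → a *ℝ a +ℝ s) (fromℤ (+ 0)) z)

-- The real RAM: index registers I 0, I 1, … holding naturals and real cells R 0, R 1, …,
-- the latter addressed only indirectly, through index registers.  Real arithmetic is exact
-- and each elementary instruction takes one step.  There is no division, square root or
-- rounding of reals, and no multiplication of indices.

record State : Set where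
  constructor ⟨_,_⟩
  field
    I : ℕ → ℕ
    R : ℕ → ℝ
open State public

_[_↦_] : {A : Set} → (ℕ → A) → ℕ → A → ℕ → A
(f [ a ↦ v ]) b = if does (a ℕ.≟ b) then v else f b

data Test : Set where
  I<I : (a b : ℕ) → Test    -- I a < I b
  R<R : (a b : ℕ) → Test    -- R (I a) < R (I b)

data Program : Set where
  skip          : Program
  _⨟_           : (p q : Program) → Program
  ifᵀ_then_else_ : (b : Test) (p q : Program) → Program
  while_run_     : (b : Test) (p : Program) → Program
  setI          : (a c : ℕ) → Program              -- I a ≔ c
  addI subI     : (a b c : ℕ) → Program            -- I a ≔ I b + I c,  I b ∸ I c
  setR          : (a : ℕ) (c : ℤ) → Program        -- R (I a) ≔ c
  addR subR mulR : (a b c : ℕ) → Program           -- R (I a) ≔ R (I b) ± R (I c),  R (I b) · R (I c)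
  query         : (a b : ℕ) → Program              -- R (I a) ≔ answer to (R (I b), …, R (I b + n - 1))

infixr 4 _⨟_

Holds : Test → State → Set
Holds (I<I a b) σ = I σ a ℕ.< I σ b
Holds (R<R a b) σ = R σ (I σ a) <ℝ R σ (I σ b)

module Execution {n : ℕ} (answer : Vector ℝ n → ℝ) where

  queryVector : State → ℕ → Vector ℝ n
  queryVector σ b i = R σ (I σ b ℕ.+ toℕ i)

  -- Run p σ t qs σ′: from σ, the program p halts in σ′ after t steps, having asked exactly
  -- the queries qs, in this order.  Reading a query vector is charged n steps.
  data Run : Program → State → ℕ → List (Vector ℝ n) → State → Set where
    skip : ∀ {σ} → Run skip σ 1 [] σ
    _⨟_  : ∀ {p q σ σ′ σ″ t t′ qs qs′} →
           Run p σ t qs σ′ → Run q σ′ t′ qs′ σ″ → Run (p ⨟ q) σ (t ℕ.+ t′) (qs ++ qs′) σ″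
    if-true  : ∀ {b p q σ σ′ t qs} → Holds b σ →
               Run p σ t qs σ′ → Run (ifᵀ b then p else q) σ (suc t) qs σ′
    if-false : ∀ {b p q σ σ′ t qs} → ¬ Holds b σ →
               Run q σ t qs σ′ → Run (ifᵀ b then p else q) σ (suc t) qs σ′
    while-true  : ∀ {b p σ σ′ σ″ t t′ qs qs′} → Holds b σ →
                  Run p σ t qs σ′ → Run (while b run p) σ′ t′ qs′ σ″ →
                  Run (while b run p) σ (suc (t ℕ.+ t′)) (qs ++ qs′) σ″
    while-false : ∀ {b p σ} → ¬ Holds b σ → Run (while b run p) σ 1 [] σ
    setI : ∀ {a c σ} → Run (setI a c) σ 1 [] ⟨ I σ [ a ↦ c ] , R σ ⟩
    addI : ∀ {a b c σ} → Run (addI a b c) σ 1 [] ⟨ I σ [ a ↦ I σ b ℕ.+ I σ c ] , R σ ⟩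
    subI : ∀ {a b c σ} → Run (subI a b c) σ 1 [] ⟨ I σ [ a ↦ I σ b ℕ.∸ I σ c ] , R σ ⟩
    setR : ∀ {a c σ} → Run (setR a c) σ 1 [] ⟨ I σ , R σ [ I σ a ↦ fromℤ c ] ⟩
    addR : ∀ {a b c σ} →
           Run (addR a b c) σ 1 [] ⟨ I σ , R σ [ I σ a ↦ R σ (I σ b) +ℝ R σ (I σ c) ] ⟩
    subR : ∀ {a b c σ} →
           Run (subR a b c) σ 1 [] ⟨ I σ , R σ [ I σ a ↦ R σ (I σ b) -ℝ R σ (I σ c) ] ⟩
    mulR : ∀ {a b c σ} →
           Run (mulR a b c) σ 1 [] ⟨ I σ , R σ [ I σ a ↦ R σ (I σ b) *ℝ R σ (I σ c) ] ⟩
    query : ∀ {a b σ} →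
            Run (query a b) σ (suc n) (queryVector σ b ∷ [])
                ⟨ I σ , R σ [ I σ a ↦ answer (queryVector σ b) ] ⟩

open Execution public using (Run)

inputState : ℕ → ℕ → State
inputState n k = ⟨ (λ _ → 0) [ 0 ↦ n ] [ 1 ↦ k ] , (λ _ → fromℤ (+ 0)) ⟩

distanceTo : ∀ {n} → Vector ℤ n → Vector ℝ n → ℝ
distanceTo y x = ‖ (λ i → x i -ℝ fromℤ (y i)) ‖₂

InBox : ∀ {n} → ℕ → Vector ℤ n → Set
InBox k y = ∀ i → ℤ.- (+ k) ℤ.≤ y i × y i ℤ.≤ + k

infix 4 _·log_≤_·log_

-- a · log m ≤ b · log l for m, l ≥ 1, exponentiated to an exact inequality of naturals.
_·log_≤_·log_ : (a m b l : ℕ) → Set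
a ·log m ≤ b ·log l = m ℕ.^ a ℕ.≤ l ℕ.^ b

-- s ≤ C · min {n, n log k / log n}.  For k = 1 the literal log k = 0 would allow no query
-- at all, although 3ⁿ vectors are possible; there, and only there, log k is read as log 2.
QueryBound : (C n k s : ℕ) → Set
QueryBound C n k s = s ℕ.≤ C ℕ.* n × s ·log n ≤ C ℕ.* n ·log (k ℕ.⊔ 2)

{-# OPTIONS --safe #-}

-- Real queries are exact and unbounded, so two of them suffice: with b = 2k + 1 and
-- x = (1, b, …, bⁿ⁻¹), the answers ‖y‖ and ‖x - y‖ to the queries 0 and x give
--   ‖y‖² + ‖x‖² - ‖x - y‖² + bⁿ = 2⟨x, y⟩ + bⁿ = 1 + 2 Σᵢ (yᵢ + k) bⁱ,
-- because bⁿ = 1 + 2 Σᵢ k bⁱ.  The numbers yᵢ + k ∈ {0, …, 2k} are the base-b digits of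
-- that sum, and are read off from the top by repeated subtraction of 2bⁱ.
module Submission where

open import Defs
open import Data.Integer.Base using (ℤ)
open import Data.List.Base using (List)
open import Data.List.Relation.Binary.Pointwise using (Pointwise)
open import Data.Fin.Base using (Fin; toℕ)
open import Data.Nat.Base using (ℕ; _+_; _*_; _^_; _≤_)
open import Data.Product using (Σ-syntax; _×_)
open import Data.Vec.Functional using (Vector; toList)

open import Data.Bool.Base using (if_then_else_)
open import Data.Empty using (⊥-elim)
import Data.Fin.Base as Fin
import Data.Fin.Properties as Fin
open import Data.Integer.Base as ℤ using (+_)
import Data.Integer.Properties as ℤ
import Data.Integer.Tactic.RingSolver as ℤ-Solver
open import Data.List.Base using ([]; _∷_; _++_)
open import Data.List.Relation.Binary.Pointwise as Pointwise using ([]; _∷_)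
open import Data.Nat.Base as ℕ using (zero; suc; _<_; s≤s; z≤n)
import Data.Nat.Properties as ℕ
import Data.Nat.Tactic.RingSolver as ℕ-Solver
open import Data.Product using (∃-syntax; _,_; proj₁; proj₂)
open import Data.Rational.Base as ℚ using (ℚ; 0ℚ; 1ℚ; ½)
import Data.Rational.Properties as ℚ
open import Data.Rational.Solver using (module +-*-Solver)
import Data.Rational.Unnormalised.Base as ℚᵘ
import Data.Rational.Unnormalised.Properties as ℚᵘ
open import Data.Vec.Functional using (foldr)
open import Function.Base using (_∘_)
open import Relation.Binary.Definitions using (tri<; tri≈; tri>)
open import Relation.Binary.PropositionalEquality
open import Relation.Nullary using (¬_; does; yes; no; contradiction)
open import Relation.Nullary.Decidable using (dec-true; dec-false)

open +-*-Solver using (solve; _:+_; _:*_; _:-_; :-_; _:=_)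

-- Real cells hold Cauchy sequences, the machine compares them only by strict order, and it has
-- neither division nor rounding. Each answer is therefore squared at once: the square converges to
-- an integer, a property that sums, differences and products preserve. Reals converging to integers
-- compare as these integers do, so a run can be followed on a model over ℤ, where all loop
-- invariants are integer arithmetic. The summand bⁿ does two jobs: it shifts the digits into {0,
-- ..., 2k}, and it leaves an odd number, so that a strict comparison with the even 2bⁱ never meets
-- a tie. The numbers grow to about b²ⁿ, but arithmetic has unit cost; the time is governed by the
-- at most 2k subtractions for each digit.

-- The embedding of ℤ in ℚ.

ι : ℤ → ℚ
ι i = i ℚ./ 1

toℚᵘ-ι : ∀ i → ℚ.toℚᵘ (ι i) ℚᵘ.≃ ℚᵘ.mkℚᵘ i 0
toℚᵘ-ι i = ℚ.toℚᵘ-fromℚᵘ (ℚᵘ.mkℚᵘ i 0)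

ι-homo-+ : ∀ i j → ι (i ℤ.+ j) ≡ ι i ℚ.+ ι j
ι-homo-+ i j = ℚ.toℚᵘ-injective (begin-equality
  ℚ.toℚᵘ (ι (i ℤ.+ j))               ≃⟨ toℚᵘ-ι (i ℤ.+ j) ⟩
  ℚᵘ.mkℚᵘ (i ℤ.+ j) 0                ≡⟨ cong₂ (λ a b → ℚᵘ.mkℚᵘ (a ℤ.+ b) 0) (ℤ.*-identityʳ i) (ℤ.*-identityʳ j) ⟨
  ℚᵘ.mkℚᵘ i 0 ℚᵘ.+ ℚᵘ.mkℚᵘ j 0       ≃⟨ ℚᵘ.+-cong (toℚᵘ-ι i) (toℚᵘ-ι j) ⟨
  ℚ.toℚᵘ (ι i) ℚᵘ.+ ℚ.toℚᵘ (ι j)     ≃⟨ ℚ.toℚᵘ-homo-+ (ι i) (ι j) ⟨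
  ℚ.toℚᵘ (ι i ℚ.+ ι j)               ∎)
  where open ℚᵘ.≤-Reasoning

ι-homo-* : ∀ i j → ι (i ℤ.* j) ≡ ι i ℚ.* ι j
ι-homo-* i j = ℚ.toℚᵘ-injective (begin-equality
  ℚ.toℚᵘ (ι (i ℤ.* j))               ≃⟨ toℚᵘ-ι (i ℤ.* j) ⟩
  ℚᵘ.mkℚᵘ i 0 ℚᵘ.* ℚᵘ.mkℚᵘ j 0       ≃⟨ ℚᵘ.*-cong (toℚᵘ-ι i) (toℚᵘ-ι j) ⟨
  ℚ.toℚᵘ (ι i) ℚᵘ.* ℚ.toℚᵘ (ι j)     ≃⟨ ℚ.toℚᵘ-homo-* (ι i) (ι j) ⟨
  ℚ.toℚᵘ (ι i ℚ.* ι j)               ∎)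
  where open ℚᵘ.≤-Reasoning

ι-homo-- : ∀ i → ι (ℤ.- i) ≡ ℚ.- ι i
ι-homo-- i = ℚ.toℚᵘ-injective (begin-equality
  ℚ.toℚᵘ (ι (ℤ.- i))               ≃⟨ toℚᵘ-ι (ℤ.- i) ⟩
  ℚᵘ.- ℚᵘ.mkℚᵘ i 0                 ≃⟨ ℚᵘ.-‿cong (toℚᵘ-ι i) ⟨
  ℚᵘ.- ℚ.toℚᵘ (ι i)                ≃⟨ ℚ.toℚᵘ-homo‿- (ι i) ⟨
  ℚ.toℚᵘ (ℚ.- ι i)                 ∎)
  where open ℚᵘ.≤-Reasoning

ι-mono-≤ : ∀ {i j} → i ℤ.≤ j → ι i ℚ.≤ ι j
ι-mono-≤ {i} {j} i≤j = ℚ.toℚᵘ-cancel-≤ (begin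
  ℚ.toℚᵘ (ι i)     ≃⟨ toℚᵘ-ι i ⟩
  ℚᵘ.mkℚᵘ i 0      ≤⟨ ℚᵘ.*≤* (ℤ.*-monoʳ-≤-nonNeg (+ 1) i≤j) ⟩
  ℚᵘ.mkℚᵘ j 0      ≃⟨ toℚᵘ-ι j ⟨
  ℚ.toℚᵘ (ι j)     ∎)
  where open ℚᵘ.≤-Reasoning

-- Reals that converge to integers: arithmetic and order.

infix 4 _⟶_ _≈ℤ_

-- Convergence mentions only the sequence of a real, never its proof of being Cauchy, so that
-- comparing two such types does not unfold Cauchy proofs.
record _⟶_ (s : ℕ → ℚ) (i : ℤ) : Set where
  constructor mk⟶
  field converges : ∀ ε → 0ℚ ℚ.< ε → ∃[ N ] ∀ n → N ≤ n → ℚ.∣ s n ℚ.- ι i ∣ ℚ.≤ ε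
open _⟶_

_≈ℤ_ : ℝ → ℤ → Set
x ≈ℤ i = seq x ⟶ i

fromℤ-≈ : ∀ i → fromℤ i ≈ℤ i
fromℤ-≈ i = mk⟶ λ ε 0<ε → 0 , λ n _ → subst (λ z → ℚ.∣ z ∣ ℚ.≤ ε) (sym (ℚ.+-inverseʳ (ι i))) (ℚ.<⇒≤ 0<ε)

+-estimate : ∀ {a b c d δ} → ℚ.∣ a ℚ.- c ∣ ℚ.≤ δ → ℚ.∣ b ℚ.- d ∣ ℚ.≤ δ →
  ℚ.∣ (a ℚ.+ b) ℚ.- (c ℚ.+ d) ∣ ℚ.≤ δ ℚ.+ δ
+-estimate {a} {b} {c} {d} {δ} ac bd = begin
  ℚ.∣ (a ℚ.+ b) ℚ.- (c ℚ.+ d) ∣              ≡⟨ cong ℚ.∣_∣ (regroup a b c d) ⟩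
  ℚ.∣ (a ℚ.- c) ℚ.+ (b ℚ.- d) ∣              ≤⟨ ℚ.∣p+q∣≤∣p∣+∣q∣ (a ℚ.- c) (b ℚ.- d) ⟩
  ℚ.∣ a ℚ.- c ∣ ℚ.+ ℚ.∣ b ℚ.- d ∣            ≤⟨ ℚ.+-mono-≤ ac bd ⟩
  δ ℚ.+ δ                                    ∎
  where
  open ℚ.≤-Reasoning
  regroup : ∀ a b c d → (a ℚ.+ b) ℚ.- (c ℚ.+ d) ≡ (a ℚ.- c) ℚ.+ (b ℚ.- d)
  regroup = solve 4 (λ a b c d → (a :+ b) :- (c :+ d) := (a :- c) :+ (b :- d)) refl

∣-∣-neg : ∀ a b → ℚ.∣ a ℚ.- b ∣ ≡ ℚ.∣ ℚ.- a ℚ.- ℚ.- b ∣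
∣-∣-neg a b = trans (sym (ℚ.∣-p∣≡∣p∣ (a ℚ.- b))) (cong ℚ.∣_∣ (ℚ.neg-distrib-+ a (ℚ.- b)))

≈ℤ-+ : ∀ {x y i j} → x ≈ℤ i → y ≈ℤ j → x +ℝ y ≈ℤ i ℤ.+ j
≈ℤ-+ {x} {y} {i} {j} p q = mk⟶ λ ε 0<ε →
  let (M , p′) = converges p (½ ℚ.* ε) (0<½* ε 0<ε)
      (N , q′) = converges q (½ ℚ.* ε) (0<½* ε 0<ε)
  in M ℕ.⊔ N , λ n le → subst₂ (λ w e → ℚ.∣ (seq x n ℚ.+ seq y n) ℚ.- w ∣ ℚ.≤ e)
       (sym (ι-homo-+ i j)) (½+½ ε)
       (+-estimate {seq x n} {seq y n} {ι i} {ι j}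
         (p′ n (ℕ.m⊔n≤o⇒m≤o M N le)) (q′ n (ℕ.m⊔n≤o⇒n≤o M N le)))

≈ℤ-- : ∀ {x y i j} → x ≈ℤ i → y ≈ℤ j → x -ℝ y ≈ℤ i ℤ.- j
≈ℤ-- {x} {y} {i} {j} p q = mk⟶ λ ε 0<ε →
  let (M , p′) = converges p (½ ℚ.* ε) (0<½* ε 0<ε)
      (N , q′) = converges q (½ ℚ.* ε) (0<½* ε 0<ε)
  in M ℕ.⊔ N , λ n le → subst₂ (λ w e → ℚ.∣ (seq x n ℚ.+ ℚ.- seq y n) ℚ.- w ∣ ℚ.≤ e)
       (sym (trans (ι-homo-+ i (ℤ.- j)) (cong (ι i ℚ.+_) (ι-homo-- j)))) (½+½ ε)
       (+-estimate {seq x n} {ℚ.- seq y n} {ι i} {ℚ.- ι j}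
         (p′ n (ℕ.m⊔n≤o⇒m≤o M N le))
         (subst (ℚ._≤ ½ ℚ.* ε) (∣-∣-neg (seq y n) (ι j)) (q′ n (ℕ.m⊔n≤o⇒n≤o M N le))))

≈ℤ-* : ∀ {x y i j} → x ≈ℤ i → y ≈ℤ j → x *ℝ y ≈ℤ i ℤ.* j
≈ℤ-* {x} {y} {i} {j} p q = mk⟶ λ ε 0<ε →
  let (A , M , 0<A , x≤A) = eventuallyBounded {seq x} (cauchy x)
      J                   = ℚ.∣ ι j ∣
      (δ , 0<δ , eq)      = divide {A ℚ.+ J} {ε} (ℚ.+-mono-<-≤ 0<A (ℚ.0≤∣p∣ (ι j))) 0<ε
      (P , p′)            = converges p δ 0<δ
      (Q , q′)            = converges q δ 0<δ
  in (M ℕ.⊔ M) ℕ.⊔ (P ℕ.⊔ Q) , λ n le →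
     let ((Mn , _) , (Pn , Qn)) = ⊔⊔-split {M} {M} {P} {Q} le
     in subst (λ w → ℚ.∣ seq x n ℚ.* seq y n ℚ.- w ∣ ℚ.≤ ε) (sym (ι-homo-* i j))
          (ℚ.≤-trans (*-estimate {seq x n} {seq y n} {ι i} {ι j} (x≤A n Mn) ℚ.≤-refl (p′ n Pn) (q′ n Qn))
            (ℚ.≤-reflexive eq))

≤+∣-∣ : ∀ a b → a ℚ.≤ b ℚ.+ ℚ.∣ a ℚ.- b ∣
≤+∣-∣ a b = ℚ.≤-trans (ℚ.≤-reflexive (solve 2 (λ a b → a := b :+ (a :- b)) refl a b))
              (ℚ.+-monoʳ-≤ b (p≤∣p∣ (a ℚ.- b)))

∣-∣-sym : ∀ a b → ℚ.∣ a ℚ.- b ∣ ≡ ℚ.∣ b ℚ.- a ∣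
∣-∣-sym a b = trans (sym (ℚ.∣-p∣≡∣p∣ (a ℚ.- b))) (cong ℚ.∣_∣ (solve 2 (λ a b → :- (a :- b) := b :- a) refl a b))

eventually-bounds : ∀ {s i} → s ⟶ i → ∀ ε → 0ℚ ℚ.< ε →
  ∃[ N ] ∀ n → N ≤ n → s n ℚ.≤ ι i ℚ.+ ε × ι i ℚ.≤ s n ℚ.+ ε
eventually-bounds {s} {i} p ε 0<ε = let (N , p′) = converges p ε 0<ε in N , λ n le →
    ℚ.≤-trans (≤+∣-∣ (s n) (ι i)) (ℚ.+-monoʳ-≤ (ι i) (p′ n le))
  , ℚ.≤-trans (≤+∣-∣ (ι i) (s n))
      (ℚ.+-monoʳ-≤ (s n) (subst (ℚ._≤ ε) (∣-∣-sym (s n) (ι i)) (p′ n le)))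

-- Moving each end by δ costs 2δ, so half of a gap of 4δ survives. It serves in both directions:
-- from the limits to the sequences in `≈ℤ-separated`, and back in `≈ℤ-≮`.
gap-shrink : ∀ {a b x y δ} → x ℚ.≤ a ℚ.+ δ → b ℚ.≤ y ℚ.+ δ →
  a ℚ.+ ((δ ℚ.+ δ) ℚ.+ (δ ℚ.+ δ)) ℚ.≤ b → x ℚ.+ (δ ℚ.+ δ) ℚ.≤ y
gap-shrink {a} {b} {x} {y} {δ} x≤a b≤y gap = begin
  x ℚ.+ (δ ℚ.+ δ)                                 ≤⟨ ℚ.+-monoˡ-≤ (δ ℚ.+ δ) x≤a ⟩
  a ℚ.+ δ ℚ.+ (δ ℚ.+ δ)                           ≡⟨ regroup a δ ⟩
  a ℚ.+ ((δ ℚ.+ δ) ℚ.+ (δ ℚ.+ δ)) ℚ.- δ           ≤⟨ ℚ.+-monoˡ-≤ (ℚ.- δ) (ℚ.≤-trans gap b≤y) ⟩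
  y ℚ.+ δ ℚ.- δ                                   ≡⟨ cancel y δ ⟩
  y                                               ∎
  where
  open ℚ.≤-Reasoning
  regroup : ∀ a δ → a ℚ.+ δ ℚ.+ (δ ℚ.+ δ) ≡ a ℚ.+ ((δ ℚ.+ δ) ℚ.+ (δ ℚ.+ δ)) ℚ.- δ
  regroup = solve 2 (λ a δ → a :+ δ :+ (δ :+ δ) := a :+ ((δ :+ δ) :+ (δ :+ δ)) :- δ) refl
  cancel : ∀ y δ → y ℚ.+ δ ℚ.- δ ≡ y
  cancel = solve 2 (λ y δ → y :+ δ :- δ := y) refl

quarter : ℚ → ℚ
quarter ε = ½ ℚ.* (½ ℚ.* ε)

0<quarter : ∀ ε → 0ℚ ℚ.< ε → 0ℚ ℚ.< quarter ε
0<quarter ε 0<ε = 0<½* (½ ℚ.* ε) (0<½* ε 0<ε)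

four-quarters : ∀ ε → (quarter ε ℚ.+ quarter ε) ℚ.+ (quarter ε ℚ.+ quarter ε) ≡ ε
four-quarters ε = trans (cong (λ h → h ℚ.+ h) (½+½ (½ ℚ.* ε))) (½+½ ε)

≈ℤ-separated : ∀ {x y i j ε} → x ≈ℤ i → y ≈ℤ j → 0ℚ ℚ.< ε → ι i ℚ.+ ε ℚ.≤ ι j → x <ℝ y
≈ℤ-separated {x} {y} {i} {j} {ε} p q 0<ε gap =
  let δ        = quarter ε
      0<δ      = 0<quarter ε 0<ε
      (M , p′) = eventually-bounds p δ 0<δ
      (N , q′) = eventually-bounds q δ 0<δ
  in δ ℚ.+ δ , ℚ.+-mono-< 0<δ 0<δ , M ℕ.⊔ N , λ n le →
     gap-shrink {ι i} {ι j} {seq x n} {seq y n} {δ}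
       (proj₁ (p′ n (ℕ.m⊔n≤o⇒m≤o M N le)))
       (proj₂ (q′ n (ℕ.m⊔n≤o⇒n≤o M N le)))
       (subst (λ d → ι i ℚ.+ d ℚ.≤ ι j) (sym (four-quarters ε)) gap)

≈ℤ-< : ∀ {x y i j} → x ≈ℤ i → y ≈ℤ j → i ℤ.< j → x <ℝ y
≈ℤ-< {x} {y} {i} {j} p q i<j = ≈ℤ-separated {x} {y} {i} {j} {ι (+ 1)} p q (ℚ.positive⁻¹ (ι (+ 1)))
  (subst (ℚ._≤ ι j) (trans (ι-homo-+ (+ 1) i) (ℚ.+-comm (ι (+ 1)) (ι i)))
    (ι-mono-≤ (ℤ.i<j⇒suc[i]≤j i<j)))

-- The false branches of `Run` demand a refutation. A proof of `x <ℝ y` carries a uniform gap ε,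
-- half of which survives in the limits: i + ε/2 ≤ j ≤ i.
≈ℤ-≮ : ∀ {x y i j} → x ≈ℤ i → y ≈ℤ j → ¬ i ℤ.< j → ¬ x <ℝ y
≈ℤ-≮ {x} {y} {i} {j} p q i≮j (ε , 0<ε , K , x<y) =
  let δ                      = quarter ε
      0<δ                    = 0<quarter ε 0<ε
      (M , p′)               = eventually-bounds p δ 0<δ
      (N , q′)               = eventually-bounds q δ 0<δ
      n                      = (M ℕ.⊔ N) ℕ.⊔ (K ℕ.⊔ K)
      ((Mn , Nn) , (Kn , _)) = ⊔⊔-split {M} {N} {K} {K} ℕ.≤-refl
      gap                    = gap-shrink {seq x n} {seq y n} {ι i} {ι j} {δ}
        (proj₂ (p′ n Mn)) (proj₁ (q′ n Nn))
        (subst (λ d → seq x n ℚ.+ d ℚ.≤ seq y n) (sym (four-quarters ε)) (x<y n Kn))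
  in ℚ.<-irrefl refl (ℚ.<-≤-trans
       (subst (ℚ._< ι i ℚ.+ (δ ℚ.+ δ)) (ℚ.+-identityʳ (ι i)) (ℚ.+-monoʳ-< (ι i) (ℚ.+-mono-< 0<δ 0<δ)))
       (ℚ.≤-trans gap (ι-mono-≤ (ℤ.≮⇒≥ i≮j))))

-- Squared distances between integer vectors.

-- The slack ε is for negative q, where the approximation is 0 and its square exceeds q. Such terms
-- do occur in a sequence with limit 0.
sqrtApprox-square-≤ : ∀ m q {ε} → 0ℚ ℚ.≤ ε → 0ℚ ℚ.≤ q ℚ.+ ε →
  sqrtApprox m q ℚ.* sqrtApprox m q ℚ.≤ q ℚ.+ ε
sqrtApprox-square-≤ m q {ε} 0≤ε 0≤q+ε with ℚ.<-cmp 0ℚ (sqrtApprox m q)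
... | tri< 0<t _ _ = ℚ.≤-trans (sqrtApprox-lower m q 0<t)
        (ℚ.≤-trans (ℚ.≤-reflexive (sym (ℚ.+-identityʳ q))) (ℚ.+-monoʳ-≤ q 0≤ε))
... | tri≈ _ 0≡t _ = subst (λ t → t ℚ.* t ℚ.≤ q ℚ.+ ε) 0≡t 0≤q+ε
... | tri> _ _ t<0 = ⊥-elim (ℚ.<-irrefl refl (ℚ.<-≤-trans t<0 (sqrtApprox-nonNeg m q)))

-- Here η is the resolution of the root t. The factor 2B + 1 comes from (t + η)² - t² = (2t + η)η ≤
-- (2B + 1)δ; the other h is the distance from q to its limit i.
square-estimate : ∀ {i q t η B δ h} → 0ℚ ℚ.≤ η → η ℚ.≤ δ → η ℚ.≤ 1ℚ → 0ℚ ℚ.< B → t ℚ.≤ B →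
  q ℚ.≤ i ℚ.+ h → i ℚ.≤ q ℚ.+ h → t ℚ.* t ℚ.≤ q ℚ.+ h → q ℚ.< (t ℚ.+ η) ℚ.* (t ℚ.+ η) →
  ((B ℚ.+ B) ℚ.+ 1ℚ) ℚ.* δ ≡ h → ℚ.∣ t ℚ.* t ℚ.- i ∣ ℚ.≤ h ℚ.+ h
square-estimate {i} {q} {t} {η} {B} {δ} {h} 0≤η η≤δ η≤1 0<B t≤B q≤i i≤q t²≤q q<t² eq = ∣∣-bound upper lower
  where
  open ℚ.≤-Reasoning
  upper : t ℚ.* t ℚ.≤ i ℚ.+ (h ℚ.+ h)
  upper = begin
    t ℚ.* t              ≤⟨ t²≤q ⟩
    q ℚ.+ h              ≤⟨ ℚ.+-monoˡ-≤ h q≤i ⟩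
    i ℚ.+ h ℚ.+ h        ≡⟨ ℚ.+-assoc i h h ⟩
    i ℚ.+ (h ℚ.+ h)      ∎
  expand : ∀ t η h → (t ℚ.+ η) ℚ.* (t ℚ.+ η) ℚ.+ h ≡ t ℚ.* t ℚ.+ (((t ℚ.+ t) ℚ.+ η) ℚ.* η ℚ.+ h)
  expand = solve 3 (λ t η h → (t :+ η) :* (t :+ η) :+ h := t :* t :+ (((t :+ t) :+ η) :* η :+ h)) refl
  lower : i ℚ.≤ t ℚ.* t ℚ.+ (h ℚ.+ h)
  lower = begin
    i                                             ≤⟨ i≤q ⟩
    q ℚ.+ h                                       ≤⟨ ℚ.+-monoˡ-≤ h (ℚ.<⇒≤ q<t²) ⟩
    (t ℚ.+ η) ℚ.* (t ℚ.+ η) ℚ.+ h                 ≡⟨ expand t η h ⟩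
    t ℚ.* t ℚ.+ (((t ℚ.+ t) ℚ.+ η) ℚ.* η ℚ.+ h)
      ≤⟨ ℚ.+-monoʳ-≤ (t ℚ.* t) (ℚ.+-monoˡ-≤ h (*-mono-≤-nonNeg 0≤η
           (ℚ.<⇒≤ (ℚ.+-mono-< (ℚ.+-mono-< 0<B 0<B) (ℚ.positive⁻¹ 1ℚ)))
           (ℚ.+-mono-≤ (ℚ.+-mono-≤ t≤B t≤B) η≤1) η≤δ)) ⟩
    t ℚ.* t ℚ.+ (((B ℚ.+ B) ℚ.+ 1ℚ) ℚ.* δ ℚ.+ h)  ≡⟨ cong (λ e → t ℚ.* t ℚ.+ (e ℚ.+ h)) eq ⟩
    t ℚ.* t ℚ.+ (h ℚ.+ h)                         ∎

√-square : ∀ {z i} → z ≈ℤ i → + 0 ℤ.≤ i → √ z *ℝ √ z ≈ℤ i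
√-square {z} {i} p 0≤i = mk⟶ λ ε 0<ε →
  let h                   = ½ ℚ.* ε
      0<h                 = 0<½* ε 0<ε
      (B , L , 0<B , t≤B) = eventuallyBounded {seq (√ z)} (cauchy (√ z))
      (δ , 0<δ , eq)      = divide {(B ℚ.+ B) ℚ.+ 1ℚ} {h}
                              (ℚ.+-mono-< (ℚ.+-mono-< 0<B 0<B) (ℚ.positive⁻¹ 1ℚ)) 0<h
      (M , η≤δ)           = archimedean {δ} 0<δ
      (N , η≤1)           = archimedean {1ℚ} (ℚ.positive⁻¹ 1ℚ)
      (K , p′)            = eventually-bounds p h 0<h
  in (L ℕ.⊔ M) ℕ.⊔ (N ℕ.⊔ K) , λ n le →
     let ((Ln , Mn) , (Nn , Kn)) = ⊔⊔-split {L} {M} {N} {K} le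
         q = seq z n
         t = sqrtApprox n q
     in subst (ℚ.∣ t ℚ.* t ℚ.- ι i ∣ ℚ.≤_) (½+½ ε)
          (square-estimate {ι i} {q} {t} {+ 1 ℚ./ suc n} {B} {δ} {h}
            (fraction-nonNeg 1 (suc n)) (η≤δ n Mn) (η≤1 n Nn) 0<B
            (ℚ.≤-trans (p≤∣p∣ t) (t≤B n Ln)) (proj₁ (p′ n Kn)) (proj₂ (p′ n Kn))
            (sqrtApprox-square-≤ n q (ℚ.<⇒≤ 0<h) (ℚ.≤-trans (ι-mono-≤ 0≤i) (proj₂ (p′ n Kn))))
            (sqrtApprox-upper n q) eq)

normSq : ∀ {n} → Vector ℤ n → ℤ
normSq = foldr (λ a s → a ℤ.* a ℤ.+ s) (+ 0)

0≤i*i : ∀ i → + 0 ℤ.≤ i ℤ.* i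
0≤i*i (+ m)        = subst (+ 0 ℤ.≤_) (ℤ.pos-* m m) (ℤ.+≤+ z≤n)
0≤i*i (ℤ.-[1+ m ]) = ℤ.+≤+ z≤n

normSq-nonNeg : ∀ {n} (u : Vector ℤ n) → + 0 ℤ.≤ normSq u
normSq-nonNeg {zero}  u = ℤ.≤-refl
normSq-nonNeg {suc n} u = ℤ.+-mono-≤ (0≤i*i (u Fin.zero)) (normSq-nonNeg (u ∘ Fin.suc))

≈ℤ-normSq : ∀ {n} {x : Vector ℝ n} {u : Vector ℤ n} → (∀ i → x i ≈ℤ u i) →
  foldr (λ a s → a *ℝ a +ℝ s) (fromℤ (+ 0)) x ≈ℤ normSq u
≈ℤ-normSq {zero}          p = fromℤ-≈ (+ 0)
≈ℤ-normSq {suc n} {x} {u} p = ≈ℤ-+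
  {x Fin.zero *ℝ x Fin.zero} {foldr (λ a s → a *ℝ a +ℝ s) (fromℤ (+ 0)) (x ∘ Fin.suc)}
  (≈ℤ-* {x Fin.zero} {x Fin.zero} (p Fin.zero) (p Fin.zero))
  (≈ℤ-normSq {x = x ∘ Fin.suc} {u ∘ Fin.suc} (p ∘ Fin.suc))

distance-square : ∀ {n} (y : Vector ℤ n) {x : Vector ℝ n} {u : Vector ℤ n} → (∀ i → x i ≈ℤ u i) →
  distanceTo y x *ℝ distanceTo y x ≈ℤ normSq (λ i → u i ℤ.- y i)
distance-square y {x} {u} p = √-square
  {foldr (λ a s → a *ℝ a +ℝ s) (fromℤ (+ 0)) (λ i → x i -ℝ fromℤ (y i))}
  (≈ℤ-normSq {x = λ i → x i -ℝ fromℤ (y i)} {λ i → u i ℤ.- y i}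
    λ i → ≈ℤ-- {x i} {fromℤ (y i)} (p i) (fromℤ-≈ (y i)))
  (normSq-nonNeg (λ i → u i ℤ.- y i))

-- Simulating runs on a model with integer cells.

[↦]-same : ∀ {A : Set} (f : ℕ → A) a v → (f [ a ↦ v ]) a ≡ v
[↦]-same f a v = cong (if_then v else f a) (dec-true (a ℕ.≟ a) refl)

[↦]-other : ∀ {A : Set} (f : ℕ → A) {a b} v → b ≢ a → (f [ a ↦ v ]) b ≡ f b
[↦]-other f {a} {b} v b≢a = cong (if_then v else f b) (dec-false (a ℕ.≟ b) (b≢a ∘ sym))

infix 4 _≋_
_≋_ : ∀ {n} → Vector ℝ n → Vector ℤ n → Set
x ≋ u = ∀ i → x i ≈ℤ u i

-- The answers enter through their squares alone: in general they are irrational.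
module Simulation {n : ℕ} (answer : Vector ℝ n → ℝ) (dist² : Vector ℤ n → ℤ)
  (answer² : ∀ {x u} → x ≋ u → answer x *ℝ answer x ≈ℤ dist² u) where

  -- A state in which every real cell holds an integer: entry i is the cell i < n, and scalar j
  -- is the cell j + n.
  record Model : Set where
    constructor ⟪_,_,_⟫
    field
      index        : ℕ → ℕ
      entry scalar : ℕ → ℤ
  open Model

  record _⊨_ (σ : State) (τ : Model) : Set where
    constructor mk⊨
    field
      index≡  : ∀ j → I σ j ≡ index τ j
      entry≈  : ∀ i → i < n → R σ i ≈ℤ entry τ i
      scalar≈ : ∀ j → R σ (j + n) ≈ℤ scalar τ j
  open _⊨_ public

  -- Pointwise, because models consist of functions. Entries from n on are left free, so total
  -- functions such as the powers of b can stand for the array.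
  record _≐_ (τ τ′ : Model) : Set where
    constructor mk≐
    field
      index≗  : ∀ j → index τ j ≡ index τ′ j
      entry≗  : ∀ i → i < n → entry τ i ≡ entry τ′ i
      scalar≗ : ∀ j → scalar τ j ≡ scalar τ′ j

  ≐-refl : ∀ {τ} → τ ≐ τ
  ≐-refl = mk≐ (λ _ → refl) (λ _ _ → refl) (λ _ → refl)

  ⊨-≐ : ∀ {σ τ τ′} → τ ≐ τ′ → σ ⊨ τ → σ ⊨ τ′
  ⊨-≐ {σ} (mk≐ i≗ e≗ s≗) (mk⊨ i≡ e≈ s≈) = mk⊨
    (λ j → trans (i≡ j) (i≗ j))
    (λ i i<n → subst (R σ i ≈ℤ_) (e≗ i i<n) (e≈ i i<n))
    (λ j → subst (R σ (j + n) ≈ℤ_) (s≗ j) (s≈ j))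

  -- Resolves an indirect address. With a numeral p, `p + n` reduces although n is a variable, so
  -- the proofs about scalar addresses are `refl` and scalar updates compute.
  data Cell (τ : Model) (a : ℕ) : Set where
    scalarᶜ : ∀ p → index τ a ≡ p + n → Cell τ a
    entryᶜ  : ∀ i → i < n → index τ a ≡ i → Cell τ a

  read : ∀ {a} τ → Cell τ a → ℤ
  read τ (scalarᶜ p _)  = scalar τ p
  read τ (entryᶜ i _ _) = entry τ i

  write : ∀ {a} τ → Cell τ a → ℤ → Model
  write τ (scalarᶜ p _)  w = ⟪ index τ , entry τ , scalar τ [ p ↦ w ] ⟫
  write τ (entryᶜ i _ _) w = ⟪ index τ , entry τ [ i ↦ w ] , scalar τ ⟫

  read-sound : ∀ {σ τ a} → σ ⊨ τ → (c : Cell τ a) → R σ (I σ a) ≈ℤ read τ c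
  read-sound {σ} {τ} {a} s (scalarᶜ p eq) =
    subst (λ e → R σ e ≈ℤ scalar τ p) (sym (trans (index≡ s a) eq)) (scalar≈ s p)
  read-sound {σ} {τ} {a} s (entryᶜ i i<n eq) =
    subst (λ e → R σ e ≈ℤ entry τ i) (sym (trans (index≡ s a) eq)) (entry≈ s i i<n)

  -- The map `addr` covers both regions of memory: `_+ n` for scalars and the identity for entries.
  update-≈ : ∀ {r r′ : ℕ → ℝ} {g : ℕ → ℤ} {w} (addr : ℕ → ℕ) p →
    (∀ j → addr j ≢ addr p → r′ (addr j) ≡ r (addr j)) → (∀ j → addr j ≡ addr p → j ≡ p) →
    r′ (addr p) ≈ℤ w → ∀ j → r (addr j) ≈ℤ g j → r′ (addr j) ≈ℤ (g [ p ↦ w ]) j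
  update-≈ {r} {r′} {g} {w} addr p other inj new j old with j ℕ.≟ p
  ... | yes refl = subst (r′ (addr p) ≈ℤ_) (sym ([↦]-same g p w)) new
  ... | no j≢p   = subst₂ _≈ℤ_ (sym (other j (j≢p ∘ inj j))) (sym ([↦]-other g w j≢p)) old

  i≢p+n : ∀ {i} p → i < n → i ≢ p + n
  i≢p+n p i<n refl = ℕ.<⇒≱ i<n (ℕ.m≤n+m n p)

  -- The new memory r′ is only specified, not given as a single update, so that two successive
  -- writes to one cell are covered as well.
  write-sound : ∀ {σ τ a w r′} → σ ⊨ τ → (c : Cell τ a) →
    (∀ e → e ≢ I σ a → r′ e ≡ R σ e) → r′ (I σ a) ≈ℤ w → ⟨ I σ , r′ ⟩ ⊨ write τ c w
  write-sound {σ} {τ} {a} {w} {r′} s (scalarᶜ p eq) other new = mk⊨ (index≡ s)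
    (λ i i<n → subst (_≈ℤ entry τ i) (sym (other i (i≢p+n p i<n ∘ λ e → trans e at))) (entry≈ s i i<n))
    (λ j → update-≈ {R σ} {r′} {scalar τ} (_+ n) p (λ j j≢ → other (j + n) (j≢ ∘ λ e → trans e at))
      (λ j → ℕ.+-cancelʳ-≡ n j p) (subst (λ e → r′ e ≈ℤ w) at new) j (scalar≈ s j))
    where at = trans (index≡ s a) eq
  write-sound {σ} {τ} {a} {w} {r′} s (entryᶜ i i<n eq) other new = mk⊨ (index≡ s)
    (λ j j<n → update-≈ {R σ} {r′} {entry τ} (λ e → e) i (λ j j≢ → other j (j≢ ∘ λ e → trans e at))
      (λ _ e → e) (subst (λ e → r′ e ≈ℤ w) at new) j (entry≈ s j j<n))
    (λ j → subst (_≈ℤ scalar τ j) (sym (other (j + n) (i≢p+n j i<n ∘ λ e → sym (trans e at)))) (scalar≈ s j))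
    where at = trans (index≡ s a) eq

  record Outcome (p : Program) (σ : State) (T : ℕ) (qs : List (Vector ℤ n)) (τ′ : Model) : Set where
    constructor outcome
    field
      {steps} : ℕ
      {asked} : List (Vector ℝ n)
      {final} : State
      halts   : Run answer p σ steps asked final
      steps≤  : steps ≤ T
      asked≋  : Pointwise _≋_ asked qs
      final⊨  : final ⊨ τ′

  open Outcome public

  -- A Hoare triple for total correctness, with a time bound T and the trace `qs` of queries.
  record Exec (p : Program) (τ : Model) (T : ℕ) (qs : List (Vector ℤ n)) (τ′ : Model) : Set where
    constructor exec
    field from : ∀ {σ} → σ ⊨ τ → Outcome p σ T qs τ′
  open Exec public

  weaken : ∀ {p τ T T′ qs τ′ τ″} → T ≤ T′ → τ′ ≐ τ″ → Exec p τ T qs τ′ → Exec p τ T′ qs τ″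
  weaken T≤T′ eq (exec f) = exec λ s → let outcome r t≤ a f⊨ = f s in
    outcome r (ℕ.≤-trans t≤ T≤T′) a (⊨-≐ eq f⊨)

  infixr 4 _⨟ᴱ_
  _⨟ᴱ_ : ∀ {p q τ τ′ τ″ T T′ qs qs′} →
    Exec p τ T qs τ′ → Exec q τ′ T′ qs′ τ″ → Exec (p ⨟ q) τ (T + T′) (qs ++ qs′) τ″
  exec f ⨟ᴱ exec g = exec λ s →
    let outcome r t≤ a s′   = f s
        outcome r′ t′≤ a′ s″ = g s′
    in outcome (Run._⨟_ r r′) (ℕ.+-mono-≤ t≤ t′≤) (Pointwise.++⁺ a a′) s″

  while-I<I : ∀ {a b p τ τ′ τ″ T T′ qs qs′} → index τ a < index τ b →
    Exec p τ T qs τ′ → Exec (while I<I a b run p) τ′ T′ qs′ τ″ →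
    Exec (while I<I a b run p) τ (suc (T + T′)) (qs ++ qs′) τ″
  while-I<I {a} {b} lt (exec f) (exec g) = exec λ s →
    let outcome r t≤ q s′    = f s
        outcome r′ t′≤ q′ s″ = g s′
    in outcome (Execution.while-true (subst₂ _<_ (sym (index≡ s a)) (sym (index≡ s b)) lt) r r′)
         (s≤s (ℕ.+-mono-≤ t≤ t′≤)) (Pointwise.++⁺ q q′) s″

  while-I≮I : ∀ {a b p τ} → ¬ index τ a < index τ b → Exec (while I<I a b run p) τ 1 [] τ
  while-I≮I {a} {b} ge = exec λ s →
    outcome (Execution.while-false λ lt → ge (subst₂ _<_ (index≡ s a) (index≡ s b) lt)) ℕ.≤-refl [] s

  while-R<R : ∀ {a b p τ τ′ τ″ T T′ qs qs′} (c : Cell τ a) (d : Cell τ b) → read τ c ℤ.< read τ d →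
    Exec p τ T qs τ′ → Exec (while R<R a b run p) τ′ T′ qs′ τ″ →
    Exec (while R<R a b run p) τ (suc (T + T′)) (qs ++ qs′) τ″
  while-R<R {a} {b} c d lt (exec f) (exec g) = exec λ {σ} s →
    let outcome r t≤ q s′    = f s
        outcome r′ t′≤ q′ s″ = g s′
    in outcome (Execution.while-true (≈ℤ-< {R σ (I σ a)} {R σ (I σ b)} (read-sound s c) (read-sound s d) lt) r r′)
         (s≤s (ℕ.+-mono-≤ t≤ t′≤)) (Pointwise.++⁺ q q′) s″

  while-R≮R : ∀ {a b p τ} (c : Cell τ a) (d : Cell τ b) → ¬ read τ c ℤ.< read τ d →
    Exec (while R<R a b run p) τ 1 [] τ
  while-R≮R {a} {b} c d ge = exec λ {σ} s → outcome
    (Execution.while-false (≈ℤ-≮ {R σ (I σ a)} {R σ (I σ b)} (read-sound s c) (read-sound s d) ge))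
    ℕ.≤-refl [] s

  setI-index : ∀ {σ τ} a v w → v ≡ w → σ ⊨ τ →
    ⟨ I σ [ a ↦ v ] , R σ ⟩ ⊨ ⟪ index τ [ a ↦ w ] , entry τ , scalar τ ⟫
  setI-index {σ} {τ} a v .v refl (mk⊨ i≡ e≈ s≈) = mk⊨ (λ j → cong (if does (a ℕ.≟ j) then v else_) (i≡ j)) e≈ s≈

  setIᴱ : ∀ {a c τ} → Exec (setI a c) τ 1 [] ⟪ index τ [ a ↦ c ] , entry τ , scalar τ ⟫
  setIᴱ {a} {c} = exec λ s → outcome Execution.setI ℕ.≤-refl [] (setI-index a c c refl s)

  addIᴱ : ∀ {a b c τ} → Exec (addI a b c) τ 1 []
    ⟪ index τ [ a ↦ index τ b + index τ c ] , entry τ , scalar τ ⟫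
  addIᴱ {a} {b} {c} = exec λ s → outcome Execution.addI ℕ.≤-refl []
    (setI-index a _ _ (cong₂ _+_ (index≡ s b) (index≡ s c)) s)

  subIᴱ : ∀ {a b c τ} → Exec (subI a b c) τ 1 []
    ⟪ index τ [ a ↦ index τ b ℕ.∸ index τ c ] , entry τ , scalar τ ⟫
  subIᴱ {a} {b} {c} = exec λ s → outcome Execution.subI ℕ.≤-refl []
    (setI-index a _ _ (cong₂ ℕ._∸_ (index≡ s b) (index≡ s c)) s)

  assign : ∀ {σ τ a x w} → σ ⊨ τ → (c : Cell τ a) → x ≈ℤ w → ⟨ I σ , R σ [ I σ a ↦ x ] ⟩ ⊨ write τ c w
  assign {σ} {a = a} {x} {w} s c x≈w = write-sound s c
    (λ e e≢ → [↦]-other (R σ) x e≢) (subst (_≈ℤ w) (sym ([↦]-same (R σ) (I σ a) x)) x≈w)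

  setRᴱ : ∀ {a i τ} (c : Cell τ a) → Exec (setR a i) τ 1 [] (write τ c i)
  setRᴱ {a} {i} c = exec λ s → outcome Execution.setR ℕ.≤-refl [] (assign s c (fromℤ-≈ i))

  addRᴱ : ∀ {a b c τ} (x : Cell τ a) (y : Cell τ b) (z : Cell τ c) →
    Exec (addR a b c) τ 1 [] (write τ x (read τ y ℤ.+ read τ z))
  addRᴱ {a} {b} {c} x y z = exec λ {σ} s → outcome Execution.addR ℕ.≤-refl []
    (assign s x (≈ℤ-+ {R σ (I σ b)} {R σ (I σ c)} (read-sound s y) (read-sound s z)))

  subRᴱ : ∀ {a b c τ} (x : Cell τ a) (y : Cell τ b) (z : Cell τ c) →
    Exec (subR a b c) τ 1 [] (write τ x (read τ y ℤ.- read τ z))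
  subRᴱ {a} {b} {c} x y z = exec λ {σ} s → outcome Execution.subR ℕ.≤-refl []
    (assign s x (≈ℤ-- {R σ (I σ b)} {R σ (I σ c)} (read-sound s y) (read-sound s z)))

  mulRᴱ : ∀ {a b c τ} (x : Cell τ a) (y : Cell τ b) (z : Cell τ c) →
    Exec (mulR a b c) τ 1 [] (write τ x (read τ y ℤ.* read τ z))
  mulRᴱ {a} {b} {c} x y z = exec λ {σ} s → outcome Execution.mulR ℕ.≤-refl []
    (assign s x (≈ℤ-* {R σ (I σ b)} {R σ (I σ c)} (read-sound s y) (read-sound s z)))

  -- Between `query` and the squaring `mulR` the cell may hold an irrational number, a state that no
  -- `Model` describes; hence both writes are treated as one.
  assign-twice : ∀ {σ τ a x x′ w} → σ ⊨ τ → (c : Cell τ a) → x′ ≈ℤ w →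
    ⟨ I σ , (R σ [ I σ a ↦ x ]) [ I σ a ↦ x′ ] ⟩ ⊨ write τ c w
  assign-twice {σ} {a = a} {x} {x′} {w} s c x′≈w = write-sound s c
    (λ e e≢ → trans ([↦]-other (R σ [ I σ a ↦ x ]) x′ e≢) ([↦]-other (R σ) x e≢))
    (subst (_≈ℤ w) (sym ([↦]-same (R σ [ I σ a ↦ x ]) (I σ a) x′)) x′≈w)

  square-≡ : ∀ {x x′ w} → x ≡ x′ → x′ *ℝ x′ ≈ℤ w → x *ℝ x ≈ℤ w
  square-≡ refl p = p

  queryVector-≋ : ∀ {σ τ b} → σ ⊨ τ → index τ b ≡ 0 → Execution.queryVector answer σ b ≋ entry τ ∘ toℕ
  queryVector-≋ {σ} {τ} {b} s b≡0 i = subst (λ e → R σ (e + toℕ i) ≈ℤ entry τ (toℕ i))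
    (sym (trans (index≡ s b) b≡0)) (entry≈ s (toℕ i) (Fin.toℕ<n i))

  queryᴱ : ∀ {a b τ} (c : Cell τ a) → index τ b ≡ 0 →
    Exec (query a b ⨟ mulR a a a) τ (suc n + 1) ((entry τ ∘ toℕ) ∷ [])
      (write τ c (dist² (entry τ ∘ toℕ)))
  queryᴱ {a} {b} c b≡0 = exec λ {σ} s → outcome (Run._⨟_ Execution.query Execution.mulR) ℕ.≤-refl
    (queryVector-≋ s b≡0 ∷ [])
    (assign-twice s c (square-≡
      ([↦]-same (R σ) (I σ a) (answer (Execution.queryVector answer σ b))) (answer² (queryVector-≋ s b≡0))))

-- The program and its memory layout.

-- Cell i < n holds bⁱ and in the end yᵢ; the scalars V, 1, B, K, P are the cells n, …, n + 4,
-- addressed by I 0, I 3, …, I 6.  I 7 is the position i in the array and I 8 is always 0.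
--   baseLoop:   B ≔ 2k + 1, K ≔ -k
--   buildLoop:  cell i ≔ bⁱ and V ≔ V + b²ⁱ for i < n, P ≔ bⁿ
--   decodeLoop: for i from n - 1 down to 0, cell i ≔ -k + (V - 1) div 2bⁱ, V ≔ 1 + (V - 1) mod 2bⁱ
-- V stays odd, so that the test P < V of digitLoop decides P ≤ V - 1.
baseLoop buildLoop digitLoop decodeLoop algorithm : Program
baseLoop = while I<I 8 1 run
  (subI 1 1 2 ⨟ addR 4 4 3 ⨟ addR 4 4 3 ⨟ subR 5 5 3)
buildLoop = while I<I 7 0 run
  (mulR 7 6 6 ⨟ addR 0 0 7 ⨟ mulR 7 6 3 ⨟ mulR 6 6 4 ⨟ addI 7 7 2)
digitLoop = while R<R 6 0 run
  (subR 0 0 6 ⨟ addR 7 7 3)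
decodeLoop = while I<I 8 7 run
  (subI 7 7 2 ⨟ addR 6 7 7 ⨟ mulR 7 5 3 ⨟ digitLoop)
algorithm =
  setI 2 1 ⨟ addI 3 2 0 ⨟ addI 4 2 3 ⨟ addI 5 2 4 ⨟ addI 6 2 5 ⨟
  setR 3 (+ 1) ⨟ setR 4 (+ 1) ⨟ setR 6 (+ 1) ⨟
  (query 0 8 ⨟ mulR 0 0 0) ⨟
  baseLoop ⨟
  buildLoop ⨟
  (query 4 8 ⨟ mulR 4 4 4) ⨟
  subR 0 0 4 ⨟ addR 0 0 6 ⨟
  decodeLoop

scalars : (V B K P : ℤ) → ℕ → ℤ
scalars V B K P 0 = V
scalars V B K P 1 = + 1
scalars V B K P 2 = B
scalars V B K P 3 = K
scalars V B K P 4 = P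
scalars V B K P _ = + 0

scalars-ext : ∀ {g : ℕ → ℤ} {V B K P} → g 0 ≡ V → g 1 ≡ + 1 → g 2 ≡ B → g 3 ≡ K → g 4 ≡ P →
  (∀ j → g (5 + j) ≡ + 0) → ∀ j → g j ≡ scalars V B K P j
scalars-ext e₀ e₁ e₂ e₃ e₄ e₅ 0 = e₀
scalars-ext e₀ e₁ e₂ e₃ e₄ e₅ 1 = e₁
scalars-ext e₀ e₁ e₂ e₃ e₄ e₅ 2 = e₂
scalars-ext e₀ e₁ e₂ e₃ e₄ e₅ 3 = e₃
scalars-ext e₀ e₁ e₂ e₃ e₄ e₅ 4 = e₄
scalars-ext e₀ e₁ e₂ e₃ e₄ e₅ (suc (suc (suc (suc (suc j))))) = e₅ j

registers : (n k i : ℕ) → ℕ → ℕ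
registers n k i 0 = n
registers n k i 1 = k
registers n k i 2 = 1
registers n k i 3 = 1 + n
registers n k i 4 = 2 + n
registers n k i 5 = 3 + n
registers n k i 6 = 4 + n
registers n k i 7 = i
registers n k i _ = 0

-- An updated register file reduces only at numerals and at indices visibly beyond the updated ones,
-- hence the split into cases.
ext₈ : ∀ {A : Set} {f g : ℕ → A} → f 0 ≡ g 0 → f 1 ≡ g 1 → f 2 ≡ g 2 → f 3 ≡ g 3 →
  f 4 ≡ g 4 → f 5 ≡ g 5 → f 6 ≡ g 6 → f 7 ≡ g 7 → (∀ j → f (8 + j) ≡ g (8 + j)) → ∀ j → f j ≡ g j
ext₈ e₀ e₁ e₂ e₃ e₄ e₅ e₆ e₇ e₈ 0 = e₀
ext₈ e₀ e₁ e₂ e₃ e₄ e₅ e₆ e₇ e₈ 1 = e₁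
ext₈ e₀ e₁ e₂ e₃ e₄ e₅ e₆ e₇ e₈ 2 = e₂
ext₈ e₀ e₁ e₂ e₃ e₄ e₅ e₆ e₇ e₈ 3 = e₃
ext₈ e₀ e₁ e₂ e₃ e₄ e₅ e₆ e₇ e₈ 4 = e₄
ext₈ e₀ e₁ e₂ e₃ e₄ e₅ e₆ e₇ e₈ 5 = e₅
ext₈ e₀ e₁ e₂ e₃ e₄ e₅ e₆ e₇ e₈ 6 = e₆
ext₈ e₀ e₁ e₂ e₃ e₄ e₅ e₆ e₇ e₈ 7 = e₇
ext₈ e₀ e₁ e₂ e₃ e₄ e₅ e₆ e₇ e₈ (suc (suc (suc (suc (suc (suc (suc (suc j)))))))) = e₈ j

i+j-j≡i : ∀ i j → i ℤ.+ j ℤ.- j ≡ i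
i+j-j≡i = ℤ-Solver.solve-∀

sq : (ℕ → ℤ) → ℕ → ℤ
sq g m = normSq {m} (g ∘ toℕ)

-- The right fold peels off entry 0, whereas `buildLoop` and `polarization` extend the sum at its
-- end.
sq-suc : ∀ g m → sq g (suc m) ≡ sq g m ℤ.+ g m ℤ.* g m
sq-suc g zero    = ℤ.+-comm (g 0 ℤ.* g 0) (+ 0)
sq-suc g (suc m) = trans (cong (λ w → g 0 ℤ.* g 0 ℤ.+ w) (sq-suc (g ∘ suc) m))
  (sym (ℤ.+-assoc (g 0 ℤ.* g 0) (sq (g ∘ suc) m) (g (suc m) ℤ.* g (suc m))))

-- Associated as algorithm is, so that the bounds for its parts add up to it definitionally.
totalTime : ℕ → ℕ → ℕ
totalTime n k = 8 + ((suc n + 1) + ((1 + k * 5) + ((1 + n * 6) +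
  ((suc n + 1) + (2 + (1 + n * (5 + (k + k) * 3)))))))

-- Base-b expansions and the loop invariants.

module Decoding (k : ℕ) (z : ℕ → ℕ) (z≤2k : ∀ j → z j ≤ k + k) where

  b : ℕ
  b = suc (k + k)

  -- Y j is written in the form in which decoding computes it.
  p Y : ℕ → ℤ
  p j = + (b ^ j)
  Y j = (+ 0 ℤ.- + k) ℤ.+ + z j

  value : ℕ → ℕ
  value zero    = 0
  value (suc m) = value m + z m * b ^ m

  -- Since 1 + 2k = b, the digits below position m never carry into it. This gives the hypothesis
  -- `v < q` of `digitᴱ`.
  value<b^ : ∀ m → value m < b ^ m
  value<b^ zero    = s≤s z≤n
  value<b^ (suc m) = ℕ.+-mono-<-≤ (value<b^ m) (ℕ.*-monoˡ-≤ (b ^ m) (z≤2k m))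

  p-suc : ∀ j → p j ℤ.* + b ≡ p (suc j)
  p-suc j = trans (sym (ℤ.pos-* (b ^ j) b)) (cong +_ (ℕ.*-comm (b ^ j) b))

  -- Passing from m to m + 1 adds Y² + p² - (p - Y)² = 2pY and, as b - 1 = 2k, also pb - p = 2kp.
  -- Together this is 2p(Y + k) = 2pz. The odd 1 is b⁰.
  polarization : ∀ m →
    sq (λ j → + 0 ℤ.- Y j) m ℤ.+ sq p m ℤ.- sq (λ j → p j ℤ.- Y j) m ℤ.+ p m ≡ + suc (2 * value m)
  polarization zero    = refl
  polarization (suc m) = begin
    sq f (suc m) ℤ.+ sq p (suc m) ℤ.- sq g (suc m) ℤ.+ p (suc m)
      ≡⟨ cong₂ ℤ._+_ (cong₂ ℤ._-_ (cong₂ ℤ._+_ (sq-suc f m) (sq-suc p m)) (sq-suc g m)) (sym (p-suc m)) ⟩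
    (sq f m ℤ.+ f m ℤ.* f m) ℤ.+ (sq p m ℤ.+ p m ℤ.* p m) ℤ.- (sq g m ℤ.+ g m ℤ.* g m) ℤ.+ p m ℤ.* (+ 1 ℤ.+ (+ k ℤ.+ + k))
      ≡⟨ step (sq f m) (sq p m) (sq g m) (p m) (+ k) (+ z m) ⟩
    (sq f m ℤ.+ sq p m ℤ.- sq g m ℤ.+ p m) ℤ.+ (+ z m ℤ.* p m ℤ.+ + z m ℤ.* p m)
      ≡⟨ cong₂ (λ u v → u ℤ.+ (v ℤ.+ v)) (polarization m) (sym (ℤ.pos-* (z m) (b ^ m))) ⟩
    + (suc (2 * value m) + (z m * b ^ m + z m * b ^ m))
      ≡⟨ cong +_ (collect (value m) (z m * b ^ m)) ⟩
    + suc (2 * value (suc m)) ∎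
    where
    open ≡-Reasoning
    f g : ℕ → ℤ
    f j = + 0 ℤ.- Y j
    g j = p j ℤ.- Y j
    step : ∀ A S D p k z → let Y = (+ 0 ℤ.- k) ℤ.+ z in
      (A ℤ.+ (+ 0 ℤ.- Y) ℤ.* (+ 0 ℤ.- Y)) ℤ.+ (S ℤ.+ p ℤ.* p) ℤ.- (D ℤ.+ (p ℤ.- Y) ℤ.* (p ℤ.- Y)) ℤ.+ p ℤ.* (+ 1 ℤ.+ (k ℤ.+ k))
      ≡ (A ℤ.+ S ℤ.- D ℤ.+ p) ℤ.+ (z ℤ.* p ℤ.+ z ℤ.* p)
    step = ℤ-Solver.solve-∀
    collect : ∀ v w → suc (2 * v) + (w + w) ≡ suc (2 * (v + w))
    collect = ℕ-Solver.solve-∀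

  module _ {n : ℕ} (answer : Vector ℝ n → ℝ) (dist² : Vector ℤ n → ℤ)
    (answer² : ∀ {x u} → x ≋ u → answer x *ℝ answer x ≈ℤ dist² u) where

    open Simulation answer dist² answer²

    state : (k i : ℕ) (e : ℕ → ℤ) (V B K P : ℤ) → Model
    state k i e V B K P = ⟪ registers n k i , e , scalars V B K P ⟫

    -- No instruction moves an index into a real cell, so k is transferred by counting its register
    -- down. B and K are general for the induction; the loop starts with B = 1 and K = 0.
    baseᴱ : ∀ m {e V B K P} → Exec baseLoop (state m 0 e V B K P) (1 + m * 5) []
      (state 0 0 e V (B ℤ.+ (+ m ℤ.+ + m)) (K ℤ.- + m) P)
    baseᴱ zero {B = B} {K} = weaken ℕ.≤-refl
      (mk≐ (λ _ → refl) (λ _ _ → refl)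
        (scalars-ext refl refl (sym (ℤ.+-identityʳ B)) (sym (ℤ.+-identityʳ K)) refl λ _ → refl))
      (while-I≮I λ ())
    baseᴱ (suc m) {B = B} {K} = weaken ℕ.≤-refl
      (mk≐ (λ _ → refl) (λ _ _ → refl) (scalars-ext refl refl (up B (+ m)) (down K (+ m)) refl λ _ → refl))
      (while-I<I (s≤s z≤n)
        (weaken ℕ.≤-refl
          (mk≐ (ext₈ refl refl refl refl refl refl refl refl λ _ → refl) (λ _ _ → refl)
            (scalars-ext refl refl refl refl refl λ _ → refl))
          (subIᴱ ⨟ᴱ addRᴱ (scalarᶜ 2 refl) (scalarᶜ 2 refl) (scalarᶜ 1 refl)
            ⨟ᴱ addRᴱ (scalarᶜ 2 refl) (scalarᶜ 2 refl) (scalarᶜ 1 refl)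
            ⨟ᴱ subRᴱ (scalarᶜ 3 refl) (scalarᶜ 3 refl) (scalarᶜ 1 refl)))
        (baseᴱ m))
      where
      up : ∀ B m → (B ℤ.+ + 1 ℤ.+ + 1) ℤ.+ (m ℤ.+ m) ≡ B ℤ.+ ((+ 1 ℤ.+ m) ℤ.+ (+ 1 ℤ.+ m))
      up = ℤ-Solver.solve-∀
      down : ∀ K m → (K ℤ.- + 1) ℤ.- m ≡ K ℤ.- (+ 1 ℤ.+ m)
      down = ℤ-Solver.solve-∀

    buildᴱ : ∀ r {i e V K} → i + r ≡ n → (∀ j → j < i → e j ≡ p j) →
      Exec buildLoop (state 0 i e (V ℤ.+ sq p i) (+ b) K (p i)) (1 + r * 6) []
        (state 0 n p (V ℤ.+ sq p n) (+ b) K (p n))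
    buildᴱ zero {i} eq built with trans (sym (ℕ.+-identityʳ i)) eq
    ... | refl = weaken ℕ.≤-refl (mk≐ (λ _ → refl) built (λ _ → refl)) (while-I≮I (ℕ.<-irrefl refl))
    buildᴱ (suc r) {i} {e} {V} {K} eq built = while-I<I i<n
      (weaken ℕ.≤-refl
        (mk≐ (ext₈ refl refl refl refl refl refl refl (ℕ.+-comm i 1) λ _ → refl) (λ _ _ → refl)
          (scalars-ext V-suc refl refl refl (p-suc i) λ _ → refl))
        -- Cell i is scratch space for b²ⁱ before it receives bⁱ; multiplication by the scalar 1
        -- acts as a copy.
        (mulRᴱ (entryᶜ i i<n refl) (scalarᶜ 4 refl) (scalarᶜ 4 refl)
          ⨟ᴱ addRᴱ (scalarᶜ 0 refl) (scalarᶜ 0 refl) (entryᶜ i i<n refl)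
          ⨟ᴱ mulRᴱ (entryᶜ i i<n refl) (scalarᶜ 4 refl) (scalarᶜ 1 refl)
          ⨟ᴱ mulRᴱ (scalarᶜ 4 refl) (scalarᶜ 4 refl) (scalarᶜ 2 refl)
          ⨟ᴱ addIᴱ))
      (buildᴱ r {V = V} (trans (sym (ℕ.+-suc i r)) eq) built′)
      where
      i<n : i < n
      i<n = subst (i <_) eq (ℕ.m<m+n i (s≤s z≤n))
      e₁ e₂ : ℕ → ℤ
      e₁ = e [ i ↦ p i ℤ.* p i ]
      e₂ = e₁ [ i ↦ p i ℤ.* + 1 ]
      V-suc : V ℤ.+ sq p i ℤ.+ e₁ i ≡ V ℤ.+ sq p (suc i)
      V-suc = trans (cong (λ w → V ℤ.+ sq p i ℤ.+ w) ([↦]-same e i (p i ℤ.* p i)))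
        (trans (ℤ.+-assoc V (sq p i) (p i ℤ.* p i)) (cong (λ w → V ℤ.+ w) (sym (sq-suc p i))))
      built′ : ∀ j → j < suc i → e₂ j ≡ p j
      built′ j (s≤s j≤i) with j ℕ.≟ i
      ... | yes refl = trans ([↦]-same e₁ i (p i ℤ.* + 1)) (ℤ.*-identityʳ (p i))
      ... | no j≢i   = trans ([↦]-other e₁ (p i ℤ.* + 1) j≢i)
                         (trans ([↦]-other e (p i ℤ.* p i) j≢i) (built j (ℕ.≤∧≢⇒< j≤i j≢i)))

    -- Here q = bⁱ, r is the part of the digit still to be counted and v the remainder below it. The
    -- final array e′ is specified rather than computed, because iterated updates of cell i do not
    -- reduce to a single one.
    digitᴱ : ∀ r {i e e′ v q B K} → i < n → v < q →
      e′ i ≡ e i ℤ.+ + r → (∀ j → j ≢ i → e′ j ≡ e j) →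
      Exec digitLoop (state 0 i e (+ suc (2 * (v + r * q))) B K (+ (q + q))) (1 + r * 3) []
        (state 0 i e′ (+ suc (2 * v)) B K (+ (q + q)))
    digitᴱ zero {i} {e} {e′} {v} {q} i<n v<q new other = weaken ℕ.≤-refl
      (mk≐ (λ _ → refl) (λ j _ → same j)
        (scalars-ext (cong (λ w → + suc (2 * w)) (ℕ.+-identityʳ v)) refl refl refl refl λ _ → refl))
      (while-R≮R (scalarᶜ 4 refl) (scalarᶜ 0 refl) λ lt → ℕ.<⇒≱ (ℤ.drop‿+<+ lt) below)
      where
      same : ∀ j → e j ≡ e′ j
      same j with j ℕ.≟ i
      ... | yes refl = sym (trans new (ℤ.+-identityʳ (e i)))
      ... | no j≢i   = sym (other j j≢i)
      below : suc (2 * (v + 0)) ≤ q + q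
      below = ℕ.≤-trans (ℕ.≤-reflexive (double v)) (ℕ.+-mono-≤ v<q (ℕ.<⇒≤ v<q))
        where
        double : ∀ v → suc (2 * (v + 0)) ≡ suc v + v
        double = ℕ-Solver.solve-∀
    digitᴱ (suc r) {i} {e} {e′} {v} {q} i<n v<q new other =
      while-R<R (scalarᶜ 4 refl) (scalarᶜ 0 refl) (ℤ.+<+ above)
        (weaken ℕ.≤-refl
          (mk≐ (λ _ → refl) (λ _ _ → refl) (scalars-ext V-pred refl refl refl refl λ _ → refl))
          (subRᴱ (scalarᶜ 0 refl) (scalarᶜ 0 refl) (scalarᶜ 4 refl)
            ⨟ᴱ addRᴱ (entryᶜ i i<n refl) (entryᶜ i i<n refl) (scalarᶜ 1 refl)))
        (digitᴱ r i<n v<q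
          (trans new (trans (sym (ℤ.+-assoc (e i) (+ 1) (+ r)))
            (cong (ℤ._+ + r) (sym ([↦]-same e i (e i ℤ.+ + 1))))))
          (λ j j≢i → trans (other j j≢i) (sym ([↦]-other e (e i ℤ.+ + 1) j≢i))))
      where
      split : ∀ v r q → suc (2 * (v + suc r * q)) ≡ suc (2 * (v + r * q)) + (q + q)
      split = ℕ-Solver.solve-∀
      above : q + q < suc (2 * (v + suc r * q))
      above = subst (q + q <_) (sym (split v r q)) (ℕ.m<n+m (q + q) {suc (2 * (v + r * q))} (s≤s z≤n))
      V-pred : + suc (2 * (v + suc r * q)) ℤ.- + (q + q) ≡ + suc (2 * (v + r * q))
      V-pred = trans (cong (λ w → + w ℤ.- + (q + q)) (split v r q))
        (i+j-j≡i (+ suc (2 * (v + r * q))) (+ (q + q)))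

    decodeTime : ℕ → ℕ
    decodeTime zero    = 1
    decodeTime (suc m) = suc (4 + z m * 3 + decodeTime m)

    finalP : ℕ → ℤ → ℤ
    finalP zero    P = P
    finalP (suc m) P = finalP m (p m ℤ.+ p m)

    -- Decoding works in place: a cell keeps its power of b until its own round, which forms 2bⁱ
    -- from it before overwriting it with -k and counting up.
    decodeᴱ : ∀ m {e B P} → m ≤ n → (∀ j → j < m → e j ≡ p j) → (∀ j → m ≤ j → j < n → e j ≡ Y j) →
      Exec decodeLoop (state 0 m e (+ suc (2 * value m)) B (+ 0 ℤ.- + k) P) (decodeTime m) []
        (state 0 0 Y (+ 1) B (+ 0 ℤ.- + k) (finalP m P))
    decodeᴱ zero _ _ decoded = weaken ℕ.≤-refl
      (mk≐ (λ _ → refl) (λ j j<n → decoded j z≤n j<n) (λ _ → refl)) (while-I≮I λ ())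
    decodeᴱ (suc m) {e} {B} {P} m<n powers decoded = while-I<I (s≤s z≤n)
      (subIᴱ ⨟ᴱ addRᴱ (scalarᶜ 4 refl) (entryᶜ m m<n refl) (entryᶜ m m<n refl)
        ⨟ᴱ weaken ℕ.≤-refl
             (mk≐ (ext₈ refl refl refl refl refl refl refl refl λ _ → refl) (λ _ _ → refl)
               (scalars-ext refl refl refl refl (cong₂ ℤ._+_ here here) λ _ → refl))
             (mulRᴱ (entryᶜ m m<n refl) (scalarᶜ 3 refl) (scalarᶜ 1 refl))
        ⨟ᴱ digitᴱ (z m) m<n (value<b^ m) new (λ j j≢m → trans ([↦]-other e (Y m) j≢m) (sym ([↦]-other e _ j≢m))))
      (decodeᴱ m (ℕ.<⇒≤ m<n)
        (λ j j<m → trans ([↦]-other e (Y m) (ℕ.<⇒≢ j<m)) (powers j (ℕ.m<n⇒m<1+n j<m)))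
        decoded′)
      where
      here : e m ≡ p m
      here = powers m ℕ.≤-refl
      K = + 0 ℤ.- + k
      new : (e [ m ↦ Y m ]) m ≡ (e [ m ↦ K ℤ.* + 1 ]) m ℤ.+ + z m
      new = trans ([↦]-same e m (Y m)) (cong (ℤ._+ + z m)
        (sym (trans ([↦]-same e m (K ℤ.* + 1)) (ℤ.*-identityʳ K))))
      decoded′ : ∀ j → m ≤ j → j < n → (e [ m ↦ Y m ]) j ≡ Y j
      decoded′ j m≤j j<n with j ℕ.≟ m
      ... | yes refl = [↦]-same e m (Y m)
      ... | no j≢m   = trans ([↦]-other e (Y m) j≢m) (decoded j (ℕ.≤∧≢⇒< m≤j (j≢m ∘ sym)) j<n)

    decodeTime-≤ : ∀ m → decodeTime m ≤ 1 + m * (5 + (k + k) * 3)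
    decodeTime-≤ zero    = ℕ.≤-refl
    decodeTime-≤ (suc m) = ℕ.≤-trans
      (ℕ.+-mono-≤ (ℕ.+-monoʳ-≤ 5 (ℕ.*-monoˡ-≤ 3 (z≤2k m))) (decodeTime-≤ m))
      (ℕ.≤-reflexive (ℕ.+-suc (5 + (k + k) * 3) (m * (5 + (k + k) * 3))))

    -- As `dist²` is abstract here, the polarization identity is a hypothesis; `polarization-y`
    -- supplies it for the distances to y.
    algorithmᴱ : dist² (λ i → + 0) ℤ.+ sq p n ℤ.- dist² (p ∘ toℕ) ℤ.+ p n ≡ + suc (2 * value n) →
      Exec algorithm ⟪ I (inputState n k) , (λ _ → + 0) , (λ _ → + 0) ⟫
        (totalTime n k)
        ((λ _ → + 0) ∷ (p ∘ toℕ) ∷ [])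
        (state 0 0 Y (+ 1) (dist² (p ∘ toℕ)) (+ 0 ℤ.- + k) (finalP n (p n)))
    algorithmᴱ identity =
      setIᴱ ⨟ᴱ addIᴱ ⨟ᴱ addIᴱ ⨟ᴱ addIᴱ ⨟ᴱ addIᴱ
        ⨟ᴱ setRᴱ (scalarᶜ 1 refl) ⨟ᴱ setRᴱ (scalarᶜ 2 refl)
        ⨟ᴱ weaken ℕ.≤-refl
             (mk≐ (ext₈ {g = registers n k 0} refl refl refl refl refl refl refl refl λ _ → refl) (λ _ _ → refl)
               (scalars-ext refl refl refl refl refl λ _ → refl))
             (setRᴱ (scalarᶜ 4 refl))
        ⨟ᴱ weaken ℕ.≤-refl
             (mk≐ (λ _ → refl) (λ _ _ → refl)
               -- `buildᴱ` starts from V + `sq p 0`, which is V + 0.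
               (scalars-ext (sym (ℤ.+-identityʳ (dist² (λ _ → + 0)))) refl refl refl refl λ _ → refl))
             (queryᴱ (scalarᶜ 0 refl) refl)
        ⨟ᴱ baseᴱ k
        ⨟ᴱ buildᴱ n {V = dist² (λ _ → + 0)} refl (λ _ ())
        ⨟ᴱ queryᴱ (scalarᶜ 2 refl) refl
        ⨟ᴱ subRᴱ (scalarᶜ 0 refl) (scalarᶜ 0 refl) (scalarᶜ 2 refl)
        ⨟ᴱ weaken ℕ.≤-refl
             (mk≐ (λ _ → refl) (λ _ _ → refl) (scalars-ext identity refl refl refl refl λ _ → refl))
             (addRᴱ (scalarᶜ 0 refl) (scalarᶜ 0 refl) (scalarᶜ 4 refl))
        ⨟ᴱ weaken (decodeTime-≤ n) ≐-refl
             (decodeᴱ n ℕ.≤-refl (λ _ _ → refl) (λ j n≤j j<n → contradiction n≤j (ℕ.<⇒≱ j<n)))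

    recovers : dist² (λ i → + 0) ℤ.+ sq p n ℤ.- dist² (p ∘ toℕ) ℤ.+ p n ≡ + suc (2 * value n) →
      Σ[ t ∈ ℕ ] Σ[ qs ∈ List (Vector ℝ n) ] Σ[ σ ∈ State ]
      (Run answer algorithm (inputState n k) t qs σ ×
       Pointwise _≋_ qs ((λ _ → + 0) ∷ (p ∘ toℕ) ∷ []) ×
       ((i : Fin n) → R σ (toℕ i) ≈ℤ Y (toℕ i)) ×
       t ≤ totalTime n k)
    recovers identity = _ , _ , _ , halts o , asked≋ o ,
      (λ i → entry≈ (final⊨ o) (toℕ i) (Fin.toℕ<n i)) , steps≤ o
      where
      o = from (algorithmᴱ identity) {inputState n k}
        (mk⊨ (λ _ → refl) (λ _ _ → fromℤ-≈ (+ 0)) (λ _ → fromℤ-≈ (+ 0)))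

-- The digits of a vector in the box.

normSq-cong : ∀ {n} {u v : Vector ℤ n} → (∀ i → u i ≡ v i) → normSq u ≡ normSq v
normSq-cong {zero}  eq = refl
normSq-cong {suc n} eq = cong₂ (λ a s → a ℤ.* a ℤ.+ s) (eq Fin.zero) (normSq-cong (eq ∘ Fin.suc))

-- The default 0 beyond n keeps the bound 2k valid at every index, as `Decoding` requires.
digits : ∀ {n} → ℕ → Vector ℤ n → ℕ → ℕ
digits {n} k y j with j ℕ.<? n
... | yes j<n = ℤ.∣ y (Fin.fromℕ< j<n) ℤ.+ + k ∣
... | no _    = 0

module _ {n k} (y : Vector ℤ n) (y∈box : InBox k y) where

  +∣y+k∣≡y+k : ∀ i → + ℤ.∣ y i ℤ.+ + k ∣ ≡ y i ℤ.+ + k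
  +∣y+k∣≡y+k i = ℤ.0≤i⇒+∣i∣≡i
    (subst (ℤ._≤ y i ℤ.+ + k) (ℤ.+-inverseˡ (+ k)) (ℤ.+-monoˡ-≤ (+ k) (proj₁ (y∈box i))))

  digits≤2k : ∀ j → digits k y j ≤ k + k
  digits≤2k j with j ℕ.<? n
  ... | yes j<n = ℤ.drop‿+≤+ (subst (ℤ._≤ + k ℤ.+ + k) (sym (+∣y+k∣≡y+k i)) (ℤ.+-monoˡ-≤ (+ k) (proj₂ (y∈box i))))
    where i = Fin.fromℕ< j<n
  ... | no _    = z≤n

  open Decoding k (digits k y) digits≤2k

  y≡Y : ∀ i → y i ≡ Y (toℕ i)
  y≡Y i with toℕ i ℕ.<? n
  ... | no i≮n  = contradiction (Fin.toℕ<n i) i≮n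
  ... | yes i<n rewrite Fin.fromℕ<-toℕ i i<n | +∣y+k∣≡y+k i = shift (y i) (+ k)
    where
    shift : ∀ y k → y ≡ (+ 0 ℤ.- k) ℤ.+ (y ℤ.+ k)
    shift = ℤ-Solver.solve-∀

  polarization-y : normSq (λ i → + 0 ℤ.- y i) ℤ.+ sq p n ℤ.- normSq (λ i → p (toℕ i) ℤ.- y i) ℤ.+ p n
    ≡ + suc (2 * value n)
  polarization-y = trans
    (cong₂ (λ u v → u ℤ.+ sq p n ℤ.- v ℤ.+ p n)
      (normSq-cong λ i → cong (λ w → + 0 ℤ.- w) (y≡Y i))
      (normSq-cong λ i → cong (λ w → p (toℕ i) ℤ.- w) (y≡Y i)))
    (polarization n)

  recovers-y = recovers (distanceTo y) (λ u → normSq (λ i → u i ℤ.- y i))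
    (λ {x} {u} → distance-square y {x} {u}) polarization-y

-- Query and time bounds.

n≤2^n : ∀ n → n ≤ 2 ^ n
n≤2^n zero    = z≤n
n≤2^n (suc n) = ℕ.+-mono-≤ (ℕ.m^n>0 2 n) (ℕ.≤-trans (n≤2^n n) (ℕ.≤-reflexive (sym (ℕ.+-identityʳ (2 ^ n)))))

-- The logarithmic part is twice log n ≤ n log 2: squaring n ≤ 2ⁿ ≤ max(k, 2)ⁿ.
two-queries : ∀ {n} k → 1 ≤ n → QueryBound 2 n k 2
two-queries {n} k 1≤n = ℕ.*-monoʳ-≤ 2 1≤n , (begin
  n ^ 2                  ≤⟨ ℕ.^-monoˡ-≤ 2 (ℕ.≤-trans (n≤2^n n) (ℕ.^-monoˡ-≤ n (ℕ.m≤n⊔m k 2))) ⟩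
  ((k ℕ.⊔ 2) ^ n) ^ 2    ≡⟨ ℕ.^-*-assoc (k ℕ.⊔ 2) n 2 ⟩
  (k ℕ.⊔ 2) ^ (n * 2)    ≡⟨ cong ((k ℕ.⊔ 2) ^_) (ℕ.*-comm n 2) ⟩
  (k ℕ.⊔ 2) ^ (2 * n)    ∎)
  where open ℕ.≤-Reasoning

-- `totalTime n k` equals 17 + 13n + 5k + 6nk. For n ≥ 1 each of 1, n, k and nk is at most (n + k)²,
-- and 41 is the sum of the coefficients.
time-bound : ∀ {n} k → 1 ≤ n → totalTime n k ≤ 41 * (n + k) ^ 2
time-bound {suc m} k _ = begin
  totalTime (suc m) k
    -- The added polynomial is the exact difference of the two sides at n = m + 1; its coefficients
    -- are all nonnegative.
    ≤⟨ ℕ.m≤m+n (totalTime (suc m) k) (69 * m + 71 * k + 76 * m * k + 41 * m * m + 41 * k * k + 11) ⟩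
  totalTime (suc m) k + (69 * m + 71 * k + 76 * m * k + 41 * m * m + 41 * k * k + 11)
    ≡⟨ expand m k ⟩
  41 * (suc m + k) ^ 2 ∎
  where
  open ℕ.≤-Reasoning
  expand : ∀ m k → 8 + ((suc (suc m) + 1) + ((1 + k * 5) + ((1 + suc m * 6) +
    ((suc (suc m) + 1) + (2 + (1 + suc m * (5 + (k + k) * 3))))))) +
    (69 * m + 71 * k + 76 * m * k + 41 * m * m + 41 * k * k + 11) ≡ 41 * ((suc m + k) * ((suc m + k) * 1))
  expand = ℕ-Solver.solve-∀

queries : ∀ {n} → ℕ → Vector (Vector ℝ n) 2
queries k Fin.zero    i = fromℤ (+ 0)
queries k (Fin.suc _) i = fromℤ (+ (suc (k + k) ^ toℕ i))

asked-queries : ∀ {n k} {qs : List (Vector ℝ n)} →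
  Pointwise _≋_ qs ((λ _ → + 0) ∷ (λ i → + (suc (k + k) ^ toℕ i)) ∷ []) →
  Pointwise (λ u v → (i : Fin n) → u i ≈ℝ v i) qs (toList (queries k))
asked-queries (x≋ ∷ x′≋ ∷ []) = (converges ∘ x≋) ∷ (converges ∘ x′≋) ∷ []

mainTheorem1 :
    Σ[ A ∈ Program ] Σ[ C ∈ ℕ ] Σ[ c ∈ ℕ ] Σ[ d ∈ ℕ ]
    ((n k : ℕ) → 2 ≤ n → 1 ≤ k →
      Σ[ s ∈ ℕ ] Σ[ x ∈ Vector (Vector ℝ n) s ]
      (QueryBound C n k s ×
      ((y : Vector ℤ n) → InBox k y →
        Σ[ t ∈ ℕ ] Σ[ qs ∈ List (Vector ℝ n) ] Σ[ σ ∈ State ]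
        (Run (distanceTo y) A (inputState n k) t qs σ ×
         Pointwise (λ u v → (i : Fin n) → u i ≈ℝ v i) qs (toList x) ×
         ((i : Fin n) → R σ (toℕ i) ≈ℝ fromℤ (y i)) ×
         t ≤ c * (n + k) ^ d))))
mainTheorem1 = algorithm , 2 , 41 , 2 , λ n k 2≤n 1≤k →
  let 1≤n = ℕ.≤-trans (s≤s z≤n) 2≤n in
  2 , queries k , two-queries k 1≤n , λ y y∈box →
  let (t , qs , σ , halting , asked , decoded , t≤) = recovers-y y y∈box
  in t , qs , σ , halting , asked-queries {k = k} asked
     , (λ i → converges (subst (R σ (toℕ i) ≈ℤ_) (sym (y≡Y y y∈box i)) (decoded i)))
     , ℕ.≤-trans t≤ (time-bound k 1≤n)
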